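{- For all integers $n\ge 0$ and all integers $k\ge j\ge 0$, \[ a_{27(k-j)+2,\;27k+4}(27n+9)\equiv a_{27(k-j)+2,\;27k+4}(27n+18)\equiv 0 \pmod 3. \]
   Context: For positive integers $r,s$, $a_{r,s}(n)$ denotes the number of multicolored partitions of $n$ in which each even part may appear in one of $r$ colors and each odd part may appear in one of $s$ colors (copies of the same part size in different colors are distinct), with $a_{r,s}(0)=1$. Equivalently, for $|q|<1$, $\sum_{n\ge0}a_{r,s}(n)q^n = f_2^{s-r}/f_1^{s}$, where $f_m=\prod_{i\ge1}(1-q^{mi})$. -}

module Defs where

open import Data.Nat using (ℕ; zero; suc; _+_; _*_; _∸_; _≤_)
open import Data.Nat.Combinatorics using (_C_)
open import Data.Bool using (Bool; true; false; if_then_else_)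
open import Data.Nat using (_%_; _≡ᵇ_; _≤ᵇ_)

colors : ℕ → ℕ → ℕ → ℕ
colors r s m = if (m % 2 ≡ᵇ 0) then r else s

multichoose : ℕ → ℕ → ℕ
multichoose zero    zero    = 1
multichoose zero    (suc t) = 0
multichoose (suc c) t       = (c + t) C t

-- parts r s m n : number of multicolored partitions of n all of whose
-- parts are ≤ m (parts of size i come in  colors r s i  colors; copies of
-- the same size in different colors are distinct, order irrelevant).
-- Recursion on the largest allowed part m: choose the multiset of colored
-- copies of m used (t copies, in multichoose (colors r s m) t ways), then
-- partition the rest using parts ≤ m - 1.
mutual
  parts : ℕ → ℕ → ℕ → ℕ → ℕ
  parts r s zero    zero    = 1
  parts r s zero    (suc n) = 0
  parts r s (suc m) n       = sumT r s m n n

  -- sum over t of multichoose(c, t) * parts(m, n - t*(m+1)) for t with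
  -- t*(m+1) ≤ n, where the budget b bounds t (b = n suffices).
  sumT : ℕ → ℕ → ℕ → ℕ → ℕ → ℕ
  sumT r s m n zero    = parts r s m n
  sumT r s m n (suc b) = sumT r s m n b + term r s m n (suc b)

  term : ℕ → ℕ → ℕ → ℕ → ℕ → ℕ
  term r s m n t with t * suc m ≤ᵇ n
  ... | true  = multichoose (colors r s (suc m)) t * parts r s m (n ∸ t * suc m)
  ... | false = 0

a : ℕ → ℕ → ℕ → ℕ
a r s n = parts r s n n

{-# OPTIONS --safe #-}

-- Write f_m = ∏ (1 - q^(mi)). Since f_m^27 ≡ f_(27m) mod 3, the generating function equals that of
-- a_(2,4), namely f₂²/f₁⁴, up to a power series in q^27, and such a factor does not mix exponents of
-- different residues mod 27. By Gauss's identity f₁²/f₂ = φ := Σ (-1)^s q^(s²), so Q := f₂²/f₁⁴ = φ⁻².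
-- Over a ring in which 3 = 0 and x³ = x, cubing substitutes q³ for q. Splitting the squares s² by
-- whether 3 divides s gives φ = φ⁹ + R with R supported on the exponents 1 mod 3. Then
--   Q = φ⁻³ φ = φ⁻³ (φ⁹ + R) = φ⁶ + R φ⁻³ = (φ²⁷ + R³)² + R φ⁻³ = φ⁵⁴ + 2 φ²⁷ R³ + R⁶ + R φ⁻³,
-- and the four summands are supported on 0 mod 27, 3 mod 9, 6 mod 9 and 1 mod 3 respectively, so no
-- exponent divisible by 9 but not by 27 occurs. Identities are taken up to a fixed degree N, so that
-- infinite products become products up to N.
module Submission where

open import Algebra.Bundles using (CommutativeRing; RawRing)
import Algebra.Properties.CommutativeSemigroup
import Algebra.Properties.CommutativeSemiring.Exp
import Algebra.Properties.Ring
import Algebra.Properties.Semiring.Mult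
import Algebra.Solver.Ring
open import Algebra.Solver.Ring.AlmostCommutativeRing using (fromCommutativeRing; _-Raw-AlmostCommutative⟶_)
open import Data.Bool as Bool using (true; false; if_then_else_)
open import Data.Maybe.Base using (Maybe; just; nothing)
open import Data.Nat as ℕ using (ℕ; zero; suc; z≤n; s≤s; NonZero)
open import Data.Nat.Combinatorics using (_C_; nCn≡1; nCk+nC[k+1]≡[n+1]C[k+1]; nCk≡nC[n∸k])
open import Data.Nat.Divisibility using (divides-refl; m∣m*n; ∣-trans)
open import Data.Nat.DivMod as ℕ using (_/_; _%_)
open import Data.Nat.Induction using (<-rec)
import Data.Nat.Properties as ℕ
open import Data.Nat.Solver using (module +-*-Solver)
open import Data.Product using (_,_)
open import Data.Sum using (_⊎_; inj₁; inj₂)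
open import Defs
open import Level using (0ℓ)
import Relation.Binary.Reasoning.Setoid as SetoidReasoning
open import Relation.Binary.PropositionalEquality as ≡ using (_≡_; _≢_)
open import Relation.Nullary using (yes; no; contradiction)

-- The field of three elements as solver coefficients, so that `solve` decides identities mod 3.
data Trit : Set where
  t0 t1 t2 : Trit

_+₃_ _*₃_ : Trit → Trit → Trit
t0 +₃ y  = y
t1 +₃ t0 = t1
t1 +₃ t1 = t2
t1 +₃ t2 = t0
t2 +₃ t0 = t2
t2 +₃ t1 = t0
t2 +₃ t2 = t1
t0 *₃ _  = t0
t1 *₃ y  = y
t2 *₃ t0 = t0
t2 *₃ t1 = t2
t2 *₃ t2 = t1

-₃_ : Trit → Trit
-₃ t0 = t0
-₃ t1 = t2
-₃ t2 = t1

tritRing : RawRing 0ℓ 0ℓ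
tritRing = record
  { Carrier = Trit ; _≈_ = _≡_ ; _+_ = _+₃_ ; _*_ = _*₃_ ; -_ = -₃_ ; 0# = t0 ; 1# = t1 }

-- Commutative rings of characteristic 3: cubing and finite products.

Characteristic3 : CommutativeRing 0ℓ 0ℓ → Set
Characteristic3 R = 1# + (1# + 1#) ≈ 0#
  where open CommutativeRing R

module Algebra₃ (R : CommutativeRing 0ℓ 0ℓ) (1+1+1≈0 : Characteristic3 R) where

  open CommutativeRing R
  open Algebra.Properties.Ring ring using (-0#≈0#; +-inverseʳ-unique)
  open Algebra.Properties.CommutativeSemiring.Exp commutativeSemiring public
  open SetoidReasoning setoid

  fromTrit : Trit → Carrier
  fromTrit t0 = 0#
  fromTrit t1 = 1#
  fromTrit t2 = 1# + 1#

  tritMorphism : tritRing -Raw-AlmostCommutative⟶ fromCommutativeRing R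
  tritMorphism = record
    { ⟦_⟧ = fromTrit ; +-homo = +-homo ; *-homo = *-homo ; -‿homo = -‿homo ; 0-homo = refl ; 1-homo = refl }
    where
    1+1+1≈0′ : (1# + 1#) + 1# ≈ 0#
    1+1+1≈0′ = trans (+-assoc 1# 1# 1#) 1+1+1≈0
    2+2≈1 : 1# ≈ (1# + 1#) + (1# + 1#)
    2+2≈1 = begin
      1#                           ≈⟨ +-identityʳ 1# ⟨
      1# + 0#                      ≈⟨ +-congˡ 1+1+1≈0 ⟨
      1# + (1# + (1# + 1#))        ≈⟨ +-assoc 1# 1# (1# + 1#) ⟨
      (1# + 1#) + (1# + 1#)        ∎
    +-homo : ∀ x y → fromTrit (x +₃ y) ≈ fromTrit x + fromTrit y
    +-homo t0 y  = sym (+-identityˡ _)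
    +-homo t1 t0 = sym (+-identityʳ _)
    +-homo t1 t1 = refl
    +-homo t1 t2 = sym 1+1+1≈0
    +-homo t2 t0 = sym (+-identityʳ _)
    +-homo t2 t1 = sym 1+1+1≈0′
    +-homo t2 t2 = 2+2≈1
    *-homo : ∀ x y → fromTrit (x *₃ y) ≈ fromTrit x * fromTrit y
    *-homo t0 y  = sym (zeroˡ _)
    *-homo t1 y  = sym (*-identityˡ _)
    *-homo t2 t0 = sym (zeroʳ _)
    *-homo t2 t1 = sym (*-identityʳ _)
    *-homo t2 t2 = trans 2+2≈1 (sym (trans (distribˡ _ _ _) (+-cong (*-identityʳ _) (*-identityʳ _))))
    -‿homo : ∀ x → fromTrit (-₃ x) ≈ - fromTrit x
    -‿homo t0 = sym -0#≈0#
    -‿homo t1 = +-inverseʳ-unique _ _ 1+1+1≈0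
    -‿homo t2 = +-inverseʳ-unique _ _ 1+1+1≈0′

  _≟₃_ : ∀ x y → Maybe (fromTrit x ≈ fromTrit y)
  t0 ≟₃ t0 = just refl
  t1 ≟₃ t1 = just refl
  t2 ≟₃ t2 = just refl
  _  ≟₃ _  = nothing

  open Algebra.Solver.Ring tritRing (fromCommutativeRing R) tritMorphism _≟₃_ public
    using (solve; _:=_; _:+_; _:*_; _:-_; :-_; con)

  cube : Carrier → Carrier
  cube x = x * x * x

  cube-cong : ∀ {x y} → x ≈ y → cube x ≈ cube y
  cube-cong x≈y = *-cong (*-cong x≈y x≈y) x≈y

  cube-+ : ∀ x y → cube (x + y) ≈ cube x + cube y
  cube-+ = solve 2 (λ x y → (x :+ y) :* (x :+ y) :* (x :+ y) := x :* x :* x :+ y :* y :* y) refl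

  cube-* : ∀ x y → cube (x * y) ≈ cube x * cube y
  cube-* = solve 2 (λ x y → (x :* y) :* (x :* y) :* (x :* y) := (x :* x :* x) :* (y :* y :* y)) refl

  cube-1- : ∀ x → cube (1# - x) ≈ 1# - cube x
  cube-1- = solve 1 (λ x → (con t1 :- x) :* (con t1 :- x) :* (con t1 :- x) := con t1 :- x :* x :* x) refl

  ^27≈cube³ : ∀ x → x ^ 27 ≈ cube (cube (cube x))
  ^27≈cube³ x = begin
    x ^ 27                ≈⟨ ^-assocʳ x 9 3 ⟨
    (x ^ 9) ^ 3           ≈⟨ ^-congˡ 3 (^-assocʳ x 3 3) ⟨
    ((x ^ 3) ^ 3) ^ 3     ≈⟨ ^3≈cube _ ⟩
    cube ((x ^ 3) ^ 3)    ≈⟨ cube-cong (^3≈cube _) ⟩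
    cube (cube (x ^ 3))   ≈⟨ cube-cong (cube-cong (^3≈cube x)) ⟩
    cube (cube (cube x))  ∎
    where
    ^3≈cube : ∀ y → y ^ 3 ≈ cube y
    ^3≈cube y = trans (*-congˡ (*-congˡ (*-identityʳ y))) (sym (*-assoc y y y))

  1^n≈1 : ∀ n → 1# ^ n ≈ 1#
  1^n≈1 zero    = refl
  1^n≈1 (suc n) = trans (*-identityˡ _) (1^n≈1 n)

  -- ∏ F m is the product of F 1, …, F m.
  ∏ : (ℕ → Carrier) → ℕ → Carrier
  ∏ F zero    = 1#
  ∏ F (suc m) = ∏ F m * F (suc m)

  interchange : ∀ a b c d → (a * b) * (c * d) ≈ (a * c) * (b * d)
  interchange = solve 4 (λ a b c d → (a :* b) :* (c :* d) := (a :* c) :* (b :* d)) refl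

  ∏-cong : ∀ {F G} → (∀ i → F (suc i) ≈ G (suc i)) → ∀ m → ∏ F m ≈ ∏ G m
  ∏-cong F≈G zero    = refl
  ∏-cong F≈G (suc m) = *-cong (∏-cong F≈G m) (F≈G m)

  ∏-* : ∀ F G m → ∏ (λ i → F i * G i) m ≈ ∏ F m * ∏ G m
  ∏-* F G zero    = sym (*-identityˡ 1#)
  ∏-* F G (suc m) = trans (*-congʳ (∏-* F G m)) (interchange _ _ _ _)

  ∏-inverse : ∀ {F G} → (∀ i → F (suc i) * G (suc i) ≈ 1#) → ∀ m → ∏ F m * ∏ G m ≈ 1#
  ∏-inverse         FG≈1 zero    = *-identityˡ 1#
  ∏-inverse {F} {G} FG≈1 (suc m) = begin
    ∏ F m * F (suc m) * (∏ G m * G (suc m))    ≈⟨ interchange _ _ _ _ ⟩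
    ∏ F m * ∏ G m * (F (suc m) * G (suc m))    ≈⟨ *-cong (∏-inverse FG≈1 m) (FG≈1 m) ⟩
    1# * 1#                                    ≈⟨ *-identityˡ 1# ⟩
    1#                                         ∎

  -- In characteristic 3 this is the coefficient 2 (-1)^s of q^(s²), s ≥ 1, in Gauss's series.
  sign : ℕ → Carrier
  sign zero    = - 1#
  sign (suc s) = - sign s

  -- Finite form of Gauss's identity, by telescoping.

  module Gauss
    (X : ℕ → Carrier)
    (X-+ : ∀ m n → X (m ℕ.+ n) ≈ X m * X n)
    (u w : ℕ → Carrier)
    (u-inverse : ∀ i → (1# + X (suc i)) * u (suc i) ≈ 1#)
    (w-inverse : ∀ i → (1# - X (suc i)) * w (suc i) ≈ 1#)
    where

    theta : ℕ → Carrier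
    theta zero    = 1#
    theta (suc n) = theta n + sign (suc n) * X (suc n ℕ.* suc n)

    -- Partial products of ∏ (1 - q^i) / (1 + q^i), the product side of Gauss's identity, and their
    -- inverses.
    P P⁻¹ : ℕ → Carrier
    P   = ∏ (λ i → (1# - X i) * u i)
    P⁻¹ = ∏ (λ i → (1# + X i) * w i)

    P-inverse : ∀ n → P n * P⁻¹ n ≈ 1#
    P-inverse = ∏-inverse λ i → begin
      ((1# - X (suc i)) * u (suc i)) * ((1# + X (suc i)) * w (suc i))
        ≈⟨ solve 4 (λ a b c d → (a :* b) :* (c :* d) := (c :* b) :* (a :* d)) refl _ _ _ _ ⟩
      ((1# + X (suc i)) * u (suc i)) * ((1# - X (suc i)) * w (suc i))
        ≈⟨ *-cong (u-inverse i) (w-inverse i) ⟩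
      1# * 1#
        ≈⟨ *-identityˡ 1# ⟩
      1# ∎

    -- Shanks's telescoping: theta n equals P n (1 + Σ_(1≤s≤n) 2 (-1)^s q^(s(n+1)) / ((1 + q^s) P s)).
    -- Here 1 / ((1 + q^s) P s) is written P⁻¹ (s - 1) / (1 - q^s), and e stands for n + 1.
    tailSum : ℕ → ℕ → Carrier
    tailSum zero    e = 0#
    tailSum (suc m) e = tailSum m e + sign (suc m) * (P⁻¹ m * w (suc m)) * X (suc m ℕ.* e)

    -- Induction on `m` with `n` fixed: each new summand turns the error term for `m` into the error
    -- term for `suc m`. At `m = n` the error term becomes half of the next term of `theta`.
    tailSum-step : ∀ m n →
      P (suc n) * (1# + tailSum m (suc (suc n))) ≈
      P n * (1# + tailSum m (suc n)) + P n * u (suc n) * (sign (suc m) * X (suc m ℕ.* suc n) * P⁻¹ m)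
    tailSum-step zero n = begin
      p * ((1# - x) * v) * (1# + 0#)
        -- Characteristic 3 enters here: 1 - x = (1 + x) + x.
        ≈⟨ solve 3 (λ p x v → p :* ((con t1 :- x) :* v) :* (con t1 :+ con t0)
             := p :* ((con t1 :+ x) :* v) :+ p :* v :* (con t1 :* x)) refl p x v ⟩
      p * ((1# + x) * v) + p * v * (1# * x)
        ≈⟨ +-cong (*-congˡ (u-inverse n)) (*-congˡ (*-congˡ (reflexive (≡.cong X (≡.sym (ℕ.*-identityˡ (suc n))))))) ⟩
      p * 1# + p * v * (1# * X (1 ℕ.* suc n))
        ≈⟨ solve 3 (λ p v z → p :* con t1 :+ p :* v :* (con t1 :* z)
             := p :* (con t1 :+ con t0) :+ p :* v :* ((:- (:- con t1)) :* z :* con t1)) refl p v _ ⟩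
      p * (1# + 0#) + p * v * (sign 1 * X (1 ℕ.* suc n) * 1#) ∎
      where
      p = P n
      x = X (suc n)
      v = u (suc n)
    tailSum-step (suc m) n = begin
      p * ((1# - x) * v) * (1# + (T₂ + ε * c * X (s ℕ.* suc (suc n))))
        ≈⟨ *-congˡ (+-congˡ (+-congˡ (*-congˡ (trans (reflexive (≡.cong X (ℕ.*-suc s (suc n)))) (X-+ s _))))) ⟩
      p * ((1# - x) * v) * (1# + (T₂ + ε * c * (y * z)))
        ≈⟨ solve 8 (λ p x v T₂ ε c y z →
             p :* ((con t1 :- x) :* v) :* (con t1 :+ (T₂ :+ ε :* c :* (y :* z)))
             := p :* ((con t1 :- x) :* v) :* (con t1 :+ T₂) :+ p :* ((con t1 :- x) :* v) :* (ε :* c :* (y :* z)))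
             refl p x v T₂ ε c y z ⟩
      p * ((1# - x) * v) * (1# + T₂) + p * ((1# - x) * v) * (ε * c * (y * z))
        ≈⟨ +-congʳ (tailSum-step m n) ⟩
      (p * (1# + T₁) + p * v * (ε * z * P⁻¹ m)) + p * ((1# - x) * v) * (ε * c * (y * z))
        ≈⟨ +-congʳ (+-congˡ (*-congˡ (*-congˡ P⁻¹≈))) ⟩
      (p * (1# + T₁) + p * v * (ε * z * ((1# - y) * c))) + p * ((1# - x) * v) * (ε * c * (y * z))
        -- Apart from the common `p * (1# + T₁)`, both sides are p v ε c z (1 - x y): (1 - y) + (1 -
        -- x) y = (1 + x) - x (1 + y).
        ≈⟨ solve 8 (λ p x v T₁ ε c y z →
             (p :* (con t1 :+ T₁) :+ p :* v :* (ε :* z :* ((con t1 :- y) :* c)))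
               :+ p :* ((con t1 :- x) :* v) :* (ε :* c :* (y :* z))
             := (p :* (con t1 :+ T₁) :+ p :* ((con t1 :+ x) :* v) :* (ε :* c :* z))
               :+ p :* v :* ((:- ε) :* (x :* z) :* ((con t1 :+ y) :* c))) refl p x v T₁ ε c y z ⟩
      (p * (1# + T₁) + p * ((1# + x) * v) * (ε * c * z)) + p * v * ((- ε) * (x * z) * ((1# + y) * c))
        ≈⟨ +-cong (+-congˡ (*-congʳ (trans (*-congˡ (u-inverse n)) (*-identityʳ p))))
                  (*-congˡ (*-cong (*-congˡ (sym (X-+ (suc n) _))) P⁻¹-suc)) ⟩
      (p * (1# + T₁) + p * (ε * c * z)) + p * v * ((- ε) * X (suc s ℕ.* suc n) * P⁻¹ s)
        ≈⟨ +-congʳ (solve 3 (λ p T t → p :* (con t1 :+ T) :+ p :* t := p :* (con t1 :+ (T :+ t))) refl p T₁ _) ⟩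
      p * (1# + (T₁ + ε * c * z)) + p * v * ((- ε) * X (suc s ℕ.* suc n) * P⁻¹ s) ∎
      where
      s  = suc m
      p  = P n
      x  = X (suc n)
      y  = X s
      z  = X (s ℕ.* suc n)
      v  = u (suc n)
      c  = P⁻¹ m * w s
      ε  = sign s
      T₁ = tailSum m (suc n)
      T₂ = tailSum m (suc (suc n))
      P⁻¹≈ : P⁻¹ m ≈ (1# - y) * c
      P⁻¹≈ = begin
        P⁻¹ m                        ≈⟨ *-identityʳ _ ⟨
        P⁻¹ m * 1#                   ≈⟨ *-congˡ (w-inverse m) ⟨
        P⁻¹ m * ((1# - y) * w s)     ≈⟨ solve 3 (λ a b d → a :* (b :* d) := b :* (a :* d)) refl _ _ _ ⟩
        (1# - y) * c                 ∎
      P⁻¹-suc : (1# + y) * c ≈ P⁻¹ s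
      P⁻¹-suc = solve 3 (λ a b d → b :* (a :* d) := a :* (b :* d)) refl _ _ _

    -- In the induction step the error term of `tailSum-step` is v ε z and the new top summand
    -- contributes x v ε z, because `P n` and `P⁻¹ n` cancel. Their sum is (1 + x) v ε z = ε z, the
    -- next term of `theta`.
    theta-tailSum : ∀ n → P n * (1# + tailSum n (suc n)) ≈ theta n
    theta-tailSum zero    = trans (*-identityˡ _) (+-identityʳ 1#)
    theta-tailSum (suc n) = begin
      p′ * (1# + (T₂ + ε * c * X (suc n ℕ.* suc (suc n))))
        ≈⟨ solve 3 (λ p T t → p :* (con t1 :+ (T :+ t)) := p :* (con t1 :+ T) :+ p :* t) refl p′ T₂ _ ⟩
      p′ * (1# + T₂) + p′ * (ε * c * X (suc n ℕ.* suc (suc n)))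
        ≈⟨ +-cong (tailSum-step n n) (*-congˡ (*-congˡ (trans (reflexive (≡.cong X (ℕ.*-suc (suc n) (suc n)))) (X-+ (suc n) _)))) ⟩
      (S + p * v * (ε * z * p⁻¹)) + p * ((1# - x) * v) * (ε * (p⁻¹ * b) * (x * z))
        ≈⟨ solve 8 (λ S p v ε z a x b →
             (S :+ p :* v :* (ε :* z :* a)) :+ p :* ((con t1 :- x) :* v) :* (ε :* (a :* b) :* (x :* z))
             := S :+ (p :* a) :* v :* (ε :* z) :* (con t1 :+ x :* ((con t1 :- x) :* b)))
             refl S p v ε z p⁻¹ x b ⟩
      S + (p * p⁻¹) * v * (ε * z) * (1# + x * ((1# - x) * b))
        ≈⟨ +-cong (theta-tailSum n) (*-cong (*-congʳ (*-congʳ (P-inverse n))) (+-congˡ (*-congˡ (w-inverse n)))) ⟩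
      theta n + 1# * v * (ε * z) * (1# + x * 1#)
        ≈⟨ solve 4 (λ t v e x → t :+ con t1 :* v :* e :* (con t1 :+ x :* con t1)
             := t :+ ((con t1 :+ x) :* v) :* e) refl (theta n) v (ε * z) x ⟩
      theta n + ((1# + x) * v) * (ε * z)
        ≈⟨ +-congˡ (trans (*-congʳ (u-inverse n)) (*-identityˡ _)) ⟩
      theta n + ε * z ∎
      where
      p′ = P (suc n)
      p  = P n
      x  = X (suc n)
      z  = X (suc n ℕ.* suc n)
      v  = u (suc n)
      b  = w (suc n)
      p⁻¹ = P⁻¹ n
      c  = p⁻¹ * b
      ε  = sign (suc n)
      S  = P n * (1# + tailSum n (suc n))
      T₂ = tailSum n (suc (suc n))

-- Formal power series and their Cauchy product.

module PowerSeries (K : CommutativeRing 0ℓ 0ℓ) where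

  open CommutativeRing K
  open Algebra.Properties.Ring ring using (-0#≈0#)
  open Algebra.Properties.CommutativeSemigroup +-commutativeSemigroup using (interchange)
  open SetoidReasoning setoid

  Series : Set
  Series = ℕ → Carrier

  tail : Series → Series
  tail f n = f (suc n)

  infixl 6 _⊕_
  infixl 7 _⊛_

  -- The Cauchy product is defined by recursion on the degree, through f = f 0 + q · `tail f`, so
  -- that the ring laws follow by induction without handling finite sums.
  _⊕_ _⊛_ : Series → Series → Series
  (f ⊕ g) n = f n + g n
  (f ⊛ g) zero    = f 0 * g 0
  (f ⊛ g) (suc n) = f 0 * g (suc n) + (tail f ⊛ g) n

  ⊖_ : Series → Series
  (⊖ f) n = - f n

  𝟘 : Series
  𝟘 _ = 0#

  X : ℕ → Series
  X zero    zero    = 1#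
  X zero    (suc n) = 0#
  X (suc m) zero    = 0#
  X (suc m) (suc n) = X m n

  scale : Carrier → Series → Series
  scale c f n = c * f n

  zero-factor : ∀ {x y} → x ≈ 0# ⊎ y ≈ 0# → x * y ≈ 0#
  zero-factor (inj₁ x≈0) = trans (*-congʳ x≈0) (zeroˡ _)
  zero-factor (inj₂ y≈0) = trans (*-congˡ y≈0) (zeroʳ _)

  ⊛-vanishes : ∀ f g n → (∀ i j → i ℕ.+ j ≡ n → f i ≈ 0# ⊎ g j ≈ 0#) → (f ⊛ g) n ≈ 0#
  ⊛-vanishes f g zero    h = zero-factor (h 0 0 ≡.refl)
  ⊛-vanishes f g (suc n) h = trans
    (+-cong (zero-factor (h 0 (suc n) ≡.refl)) (⊛-vanishes (tail f) g n λ i j e → h (suc i) j (≡.cong suc e)))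
    (+-identityˡ 0#)

  ⊛-cong : ∀ {f f′ g g′} n → (∀ i → i ℕ.≤ n → f i ≈ f′ i) → (∀ i → i ℕ.≤ n → g i ≈ g′ i) →
           (f ⊛ g) n ≈ (f′ ⊛ g′) n
  ⊛-cong zero    p q = *-cong (p 0 z≤n) (q 0 z≤n)
  ⊛-cong (suc n) p q = +-cong (*-cong (p 0 z≤n) (q (suc n) ℕ.≤-refl))
    (⊛-cong n (λ i i≤n → p (suc i) (s≤s i≤n)) (λ i i≤n → q i (ℕ.m≤n⇒m≤1+n i≤n)))

  -- Mirror image of the defining recursion: the last summand is split off instead of the first.
  -- Commutativity rests on it.
  ⊛-sucʳ : ∀ f g n → (f ⊛ g) (suc n) ≈ (f ⊛ tail g) n + f (suc n) * g 0
  ⊛-sucʳ f g zero    = refl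
  ⊛-sucʳ f g (suc n) = trans (+-congˡ (⊛-sucʳ (tail f) g n)) (sym (+-assoc _ _ _))

  ⊛-comm : ∀ f g n → (f ⊛ g) n ≈ (g ⊛ f) n
  ⊛-comm f g zero    = *-comm _ _
  ⊛-comm f g (suc n) = begin
    f 0 * g (suc n) + (tail f ⊛ g) n  ≈⟨ +-cong (*-comm _ _) (⊛-comm (tail f) g n) ⟩
    g (suc n) * f 0 + (g ⊛ tail f) n  ≈⟨ +-comm _ _ ⟩
    (g ⊛ tail f) n + g (suc n) * f 0  ≈⟨ ⊛-sucʳ g f n ⟨
    (g ⊛ f) (suc n)                   ∎

  ⊛-distribʳ : ∀ h f g n → ((f ⊕ g) ⊛ h) n ≈ (f ⊛ h) n + (g ⊛ h) n
  ⊛-distribʳ h f g zero    = distribʳ _ _ _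
  ⊛-distribʳ h f g (suc n) =
    trans (+-cong (distribʳ _ _ _) (⊛-distribʳ h (tail f) (tail g) n)) (interchange _ _ _ _)

  ⊛-scale : ∀ c f g n → (scale c f ⊛ g) n ≈ c * (f ⊛ g) n
  ⊛-scale c f g zero    = *-assoc _ _ _
  ⊛-scale c f g (suc n) = trans (+-cong (*-assoc _ _ _) (⊛-scale c (tail f) g n)) (sym (distribˡ _ _ _))

  -- By definition `tail (f ⊛ g)` is `scale (f 0) (tail g) ⊕ tail f ⊛ g`, so distributivity and
  -- induction on the degree suffice.
  ⊛-assoc : ∀ f g h n → ((f ⊛ g) ⊛ h) n ≈ (f ⊛ (g ⊛ h)) n
  ⊛-assoc f g h zero    = *-assoc _ _ _
  ⊛-assoc f g h (suc n) = begin
    f 0 * g 0 * h (suc n) + ((scale (f 0) (tail g) ⊕ tail f ⊛ g) ⊛ h) n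
      ≈⟨ +-cong (*-assoc _ _ _) (⊛-distribʳ h (scale (f 0) (tail g)) (tail f ⊛ g) n) ⟩
    f 0 * (g 0 * h (suc n)) + ((scale (f 0) (tail g) ⊛ h) n + (tail f ⊛ g ⊛ h) n)
      ≈⟨ +-congˡ (+-cong (⊛-scale (f 0) (tail g) h n) (⊛-assoc (tail f) g h n)) ⟩
    f 0 * (g 0 * h (suc n)) + (f 0 * (tail g ⊛ h) n + (tail f ⊛ (g ⊛ h)) n)
      ≈⟨ +-assoc _ _ _ ⟨
    f 0 * (g 0 * h (suc n)) + f 0 * (tail g ⊛ h) n + (tail f ⊛ (g ⊛ h)) n
      ≈⟨ +-congʳ (distribˡ _ _ _) ⟨
    f 0 * (g 0 * h (suc n) + (tail g ⊛ h) n) + (tail f ⊛ (g ⊛ h)) n ∎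

  𝟘-⊛ : ∀ f n → (𝟘 ⊛ f) n ≈ 0#
  𝟘-⊛ f n = ⊛-vanishes 𝟘 f n λ _ _ _ → inj₁ refl

  X⊛-suc : ∀ m f n → (X (suc m) ⊛ f) (suc n) ≈ (X m ⊛ f) n
  X⊛-suc m f n = trans (+-congʳ (zeroˡ _)) (+-identityˡ _)

  ⊛-identityˡ : ∀ f n → (X 0 ⊛ f) n ≈ f n
  ⊛-identityˡ f zero    = *-identityˡ _
  ⊛-identityˡ f (suc n) = trans (+-cong (*-identityˡ _) (𝟘-⊛ f n)) (+-identityʳ _)

  X⊛-+ : ∀ m f n → (X m ⊛ f) (m ℕ.+ n) ≈ f n
  X⊛-+ zero    f n = ⊛-identityˡ f n
  X⊛-+ (suc m) f n = trans (X⊛-suc m f (m ℕ.+ n)) (X⊛-+ m f n)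

  X⊛-< : ∀ m f n → n ℕ.< m → (X m ⊛ f) n ≈ 0#
  X⊛-< (suc m) f zero    _         = zeroˡ _
  X⊛-< (suc m) f (suc n) (s≤s n<m) = trans (X⊛-suc m f n) (X⊛-< m f n n<m)

  X-≢ : ∀ m n → n ≢ m → X m n ≈ 0#
  X-≢ zero    zero    n≢m = contradiction ≡.refl n≢m
  X-≢ zero    (suc n) n≢m = refl
  X-≢ (suc m) zero    n≢m = refl
  X-≢ (suc m) (suc n) n≢m = X-≢ m n λ e → n≢m (≡.cong suc e)

  X⊛X : ∀ m k n → (X m ⊛ X k) n ≈ X (m ℕ.+ k) n
  X⊛X zero    k n       = ⊛-identityˡ (X k) n
  X⊛X (suc m) k zero    = zeroˡ _
  X⊛X (suc m) k (suc n) = trans (X⊛-suc m (X k) n) (X⊛X m k n)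

  -- The ring of power series modulo q^(N+1).

  module Truncated (N : ℕ) where

    infix 4 _≋_
    -- A record rather than a bare function type, so that unification can recover `f` and `g` from
    -- the type of a proof.
    record _≋_ (f g : Series) : Set where
      constructor agree
      field coefficient : ∀ n → n ℕ.≤ N → f n ≈ g n
    open _≋_ public

    pointwise : ∀ {f g} → (∀ n → f n ≈ g n) → f ≋ g
    pointwise e = agree λ n _ → e n

    ⊛-cong≋ : ∀ {f f′ g g′} → f ≋ f′ → g ≋ g′ → f ⊛ g ≋ f′ ⊛ g′
    ⊛-cong≋ (agree p) (agree q) = agree λ n n≤N →
      ⊛-cong n (λ i i≤n → p i (ℕ.≤-trans i≤n n≤N)) (λ i i≤n → q i (ℕ.≤-trans i≤n n≤N))

    seriesRing : CommutativeRing 0ℓ 0ℓ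
    seriesRing = record
      { Carrier = Series
      ; _≈_ = _≋_
      ; _+_ = _⊕_
      ; _*_ = _⊛_
      ; -_ = ⊖_
      ; 0# = 𝟘
      ; 1# = X 0
      ; isCommutativeRing = record
        { isRing = record
          { +-isAbelianGroup = record
            { isGroup = record
              { isMonoid = record
                { isSemigroup = record
                  { isMagma = record
                    { isEquivalence = record
                      { refl  = pointwise λ _ → refl
                      ; sym   = λ (agree p) → agree λ n n≤N → sym (p n n≤N)
                      ; trans = λ (agree p) (agree q) → agree λ n n≤N → trans (p n n≤N) (q n n≤N)
                      }
                    ; ∙-cong = λ (agree p) (agree q) → agree λ n n≤N → +-cong (p n n≤N) (q n n≤N)
                    }
                  ; assoc = λ f g h → pointwise λ n → +-assoc (f n) (g n) (h n)
                  }
                ; identity = (λ f → pointwise λ n → +-identityˡ (f n)) , (λ f → pointwise λ n → +-identityʳ (f n))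
                }
              ; inverse = (λ f → pointwise λ n → -‿inverseˡ (f n)) , (λ f → pointwise λ n → -‿inverseʳ (f n))
              ; ⁻¹-cong = λ (agree p) → agree λ n n≤N → -‿cong (p n n≤N)
              }
            ; comm = λ f g → pointwise λ n → +-comm (f n) (g n)
            }
          ; *-cong = ⊛-cong≋
          ; *-assoc = λ f g h → pointwise (⊛-assoc f g h)
          ; *-identity = (λ f → pointwise (⊛-identityˡ f)) ,
                         (λ f → pointwise λ n → trans (⊛-comm f (X 0) n) (⊛-identityˡ f n))
          ; distrib = (λ h f g → pointwise λ n → begin
                        (h ⊛ (f ⊕ g)) n          ≈⟨ ⊛-comm h (f ⊕ g) n ⟩
                        ((f ⊕ g) ⊛ h) n          ≈⟨ ⊛-distribʳ h f g n ⟩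
                        (f ⊛ h) n + (g ⊛ h) n    ≈⟨ +-cong (⊛-comm f h n) (⊛-comm g h n) ⟩
                        (h ⊛ f) n + (h ⊛ g) n    ∎) ,
                      (λ h f g → pointwise (⊛-distribʳ h f g))
          }
        ; *-comm = λ f g → pointwise (⊛-comm f g)
        }
      }

    X≋𝟘 : ∀ {m} → N ℕ.< m → X m ≋ 𝟘
    X≋𝟘 N<m = agree λ n n≤N → X-≢ _ n (ℕ.<⇒≢ (ℕ.≤-<-trans n≤N N<m))

    X-+ : ∀ m n → X (m ℕ.+ n) ≋ X m ⊛ X n
    X-+ m n = pointwise λ i → sym (X⊛X m n i)

    -- Series supported on one residue class of exponents.

    Supported : (k : ℕ) .{{_ : NonZero k}} → ℕ → Series → Set
    Supported k a f = ∀ n → n ℕ.≤ N → n % k ≢ a → f n ≈ 0#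

    module _ (k : ℕ) .{{_ : NonZero k}} where

      supported-𝟘 : ∀ {a} → Supported k a 𝟘
      supported-𝟘 n n≤N n≢a = refl

      supported-⊕ : ∀ {a f g} → Supported k a f → Supported k a g → Supported k a (f ⊕ g)
      supported-⊕ sf sg n n≤N n≢a = trans (+-cong (sf n n≤N n≢a) (sg n n≤N n≢a)) (+-identityˡ 0#)

      supported-⊖ : ∀ {a f} → Supported k a f → Supported k a (⊖ f)
      supported-⊖ sf n n≤N n≢a = trans (-‿cong (sf n n≤N n≢a)) -0#≈0#

      supported-X : ∀ {a} m → m % k ≡ a → Supported k a (X m)
      supported-X m m≡a n n≤N n≢a = X-≢ m n λ { ≡.refl → n≢a m≡a }

      supported-⊛ : ∀ {a b f g} → Supported k a f → Supported k b g → Supported k ((a ℕ.+ b) % k) (f ⊛ g)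
      supported-⊛ {a} {b} {f} {g} sf sg n n≤N n≢a+b = ⊛-vanishes f g n factor-zero
        where
        factor-zero : ∀ i j → i ℕ.+ j ≡ n → f i ≈ 0# ⊎ g j ≈ 0#
        factor-zero i j ≡.refl with i % k ℕ.≟ a | j % k ℕ.≟ b
        ... | no i≢a     | _          = inj₁ (sf i (ℕ.≤-trans (ℕ.m≤m+n i j) n≤N) i≢a)
        ... | yes _      | no j≢b     = inj₂ (sg j (ℕ.≤-trans (ℕ.m≤n+m j i) n≤N) j≢b)
        ... | yes ≡.refl | yes ≡.refl = contradiction (ℕ.%-distribˡ-+ i j k) n≢a+b

-- Multiset coefficients and numbers of colors.

multichoose-zero : ∀ c → multichoose c 0 ≡ 1
multichoose-zero zero    = ≡.refl
multichoose-zero (suc c) = ≡.trans (nCk≡nC[n∸k] {n = c ℕ.+ 0} z≤n) (nCn≡1 (c ℕ.+ 0))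

-- A multiset either avoids a chosen color or contains it, and in the latter case one copy can be
-- removed.
multichoose-pascal : ∀ c t → multichoose (suc c) (suc t) ≡ multichoose c (suc t) ℕ.+ multichoose (suc c) t
multichoose-pascal zero    t = ≡.trans (nCn≡1 (suc t)) (≡.sym (nCn≡1 t))
multichoose-pascal (suc c) t = begin
  suc (c ℕ.+ suc t) C suc t                            ≡⟨ nCk+nC[k+1]≡[n+1]C[k+1] (c ℕ.+ suc t) t ⟨
  (c ℕ.+ suc t) C t ℕ.+ (c ℕ.+ suc t) C suc t          ≡⟨ ℕ.+-comm ((c ℕ.+ suc t) C t) _ ⟩
  (c ℕ.+ suc t) C suc t ℕ.+ (c ℕ.+ suc t) C t          ≡⟨ ≡.cong (λ k → (c ℕ.+ suc t) C suc t ℕ.+ k C t) (ℕ.+-suc c t) ⟩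
  (c ℕ.+ suc t) C suc t ℕ.+ (suc c ℕ.+ t) C t          ∎
  where open ≡.≡-Reasoning

colors-linear : ∀ c d d′ e e′ i →
  colors (c ℕ.* d ℕ.+ e) (c ℕ.* d′ ℕ.+ e′) i ≡ c ℕ.* colors d d′ i ℕ.+ colors e e′ i
colors-linear c d d′ e e′ i with i % 2 ℕ.≡ᵇ 0
... | true  = ≡.refl
... | false = ≡.refl

SelfCubed : CommutativeRing 0ℓ 0ℓ → Set
SelfCubed K = ∀ x → x * x * x ≈ x
  where open CommutativeRing K

-- Truncated series in characteristic 3: cubing and inverses.

module Series₃
  (K : CommutativeRing 0ℓ 0ℓ) (1+1+1≈0 : Characteristic3 K) (x³≈x : SelfCubed K) (N : ℕ)
  where

  open CommutativeRing K hiding (_-_)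
  open PowerSeries K public
  open Truncated N public

  module S = CommutativeRing seriesRing
  open S using (_-_) renaming (1# to 𝟙)
  open SetoidReasoning S.setoid

  series-characteristic3 : Characteristic3 seriesRing
  series-characteristic3 = pointwise λ where
    zero    → 1+1+1≈0
    (suc n) → trans (+-identityˡ _) (+-identityˡ _)

  open Algebra₃ seriesRing series-characteristic3 public

  const : Carrier → Series
  const c = scale c 𝟙

  const-⊛ : ∀ c f n → (const c ⊛ f) n ≈ c * f n
  const-⊛ c f n = trans (⊛-scale c 𝟙 f n) (*-congˡ (⊛-identityˡ f n))

  const-* : ∀ c d → const (c * d) ≋ const c ⊛ const d
  const-* c d = pointwise λ n → trans (*-assoc c d _) (sym (const-⊛ c (const d) n))

  cube-X : ∀ m → cube (X m) ≋ X (m ℕ.* 3)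
  cube-X m = begin
    X m ⊛ X m ⊛ X m       ≈⟨ S.*-congʳ (X-+ m m) ⟨
    X (m ℕ.+ m) ⊛ X m     ≈⟨ X-+ (m ℕ.+ m) m ⟨
    X (m ℕ.+ m ℕ.+ m)     ≡⟨ ≡.cong X (+-*-Solver.solve 1 (λ m → m :+ℕ m :+ℕ m :=ℕ m :*ℕ +-*-Solver.con 3) ≡.refl m) ⟩
    X (m ℕ.* 3)           ∎
    where open +-*-Solver using () renaming (_:+_ to _:+ℕ_; _:*_ to _:*ℕ_; _:=_ to _:=ℕ_)

  -- The recursive form of f(q)³ = f(q³): cubing is additive, and x³ = x fixes the constant
  -- coefficient of f = f 0 + q · `tail f`.
  cube-split : ∀ f → cube f ≋ const (f 0) ⊕ X 3 ⊛ cube (tail f)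
  cube-split f = begin
    cube f                                                ≈⟨ cube-cong split ⟩
    cube (const (f 0) ⊕ X 1 ⊛ tail f)                     ≈⟨ cube-+ (const (f 0)) (X 1 ⊛ tail f) ⟩
    cube (const (f 0)) ⊕ cube (X 1 ⊛ tail f)              ≈⟨ S.+-cong cube-const (S.trans (cube-* (X 1) (tail f)) (S.*-congʳ (cube-X 1))) ⟩
    const (f 0) ⊕ X 3 ⊛ cube (tail f)                     ∎
    where
    split : f ≋ const (f 0) ⊕ X 1 ⊛ tail f
    split = pointwise λ where
      zero    → sym (trans (+-cong (*-identityʳ _) (zeroˡ _)) (+-identityʳ _))
      (suc n) → sym (trans (+-cong (zeroʳ _) (X⊛-+ 1 (tail f) n)) (+-identityˡ _))
    cube-const : cube (const (f 0)) ≋ const (f 0)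
    cube-const = begin
      const (f 0) ⊛ const (f 0) ⊛ const (f 0)   ≈⟨ S.*-congʳ (const-* (f 0) (f 0)) ⟨
      const (f 0 * f 0) ⊛ const (f 0)           ≈⟨ const-* (f 0 * f 0) (f 0) ⟨
      const (f 0 * f 0 * f 0)                   ≈⟨ pointwise (λ n → *-congʳ (x³≈x (f 0))) ⟩
      const (f 0)                               ∎

  cube-step : ∀ f n → 3 ℕ.+ n ℕ.≤ N → cube f (3 ℕ.+ n) ≈ cube (tail f) n
  cube-step f n n≤N = trans (coefficient (cube-split f) (3 ℕ.+ n) n≤N)
    (trans (+-cong (zeroʳ _) (X⊛-+ 3 (cube (tail f)) n)) (+-identityˡ _))

  cube-multiple : ∀ f m → m ℕ.* 3 ℕ.≤ N → cube f (m ℕ.* 3) ≈ f m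
  cube-multiple f zero    m≤N = trans (coefficient (cube-split f) 0 m≤N)
    (trans (+-cong (*-identityʳ _) (zeroˡ _)) (+-identityʳ _))
  cube-multiple f (suc m) m≤N = trans (cube-step f (m ℕ.* 3) m≤N)
    (cube-multiple (tail f) m (ℕ.≤-trans (ℕ.m≤n+m _ 3) m≤N))

  cube-nonmultiple : ∀ f r m → suc r ℕ.< 3 → m ℕ.* 3 ℕ.+ suc r ℕ.≤ N → cube f (m ℕ.* 3 ℕ.+ suc r) ≈ 0#
  cube-nonmultiple f r zero r<3 ≤N = trans (coefficient (cube-split f) (suc r) ≤N)
    (trans (+-cong (zeroʳ _) (X⊛-< 3 (cube (tail f)) (suc r) r<3)) (+-identityˡ _))
  cube-nonmultiple f r (suc m) r<3 ≤N = trans (cube-step f (m ℕ.* 3 ℕ.+ suc r) ≤N)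
    (cube-nonmultiple (tail f) r m r<3 (ℕ.≤-trans (ℕ.m≤n+m _ 3) ≤N))

  -- Since f(q)³ = f(q³), the coefficient at n = 3m is `f m`, and n mod 3k is three times m mod k.
  -- At all other n the coefficient is zero.
  supported-cube : ∀ k .{{_ : NonZero k}} .{{_ : NonZero (k ℕ.* 3)}} {a f} →
    Supported k a f → Supported (k ℕ.* 3) (a ℕ.* 3) (cube f)
  supported-cube k {a} {f} sf n n≤N n≢3a
    with n % 3 | n / 3 | ≡.trans (ℕ.m≡m%n+[m/n]*n n 3) (ℕ.+-comm (n % 3) _) | ℕ.m%n<n n 3
  ... | zero | m | n≡3m | _ rewrite ≡.trans n≡3m (ℕ.+-identityʳ (m ℕ.* 3)) =
        trans (cube-multiple f m n≤N)
          (sf m (ℕ.≤-trans (ℕ.m≤m*n m 3) n≤N) λ m≡a →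
            n≢3a (≡.trans (≡.sym (ℕ.m%n*o≡m*o%[n*o] m k 3)) (≡.cong (ℕ._* 3) m≡a)))
  ... | suc r | m | ≡.refl | r<3 = cube-nonmultiple f r m r<3 n≤N

  X-^ : ∀ m n → X m ^ n ≋ X (n ℕ.* m)
  X-^ m zero    = S.refl
  X-^ m (suc n) = S.trans (S.*-congˡ (X-^ m n)) (S.sym (X-+ m (n ℕ.* m)))

  geometric : Series → ℕ → Series
  geometric x zero    = 𝟘
  geometric x (suc n) = geometric x n ⊕ x ^ n

  geometric-sum : ∀ x n → (𝟙 - x) ⊛ geometric x n ≋ 𝟙 - x ^ n
  geometric-sum x zero    = solve 1 (λ x → (con t1 :- x) :* con t0 := con t1 :- con t1) S.refl x
  geometric-sum x (suc n) = begin
    (𝟙 - x) ⊛ (geometric x n ⊕ x ^ n)                  ≈⟨ S.distribˡ (𝟙 - x) (geometric x n) (x ^ n) ⟩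
    (𝟙 - x) ⊛ geometric x n ⊕ (𝟙 - x) ⊛ x ^ n          ≈⟨ S.+-congʳ (geometric-sum x n) ⟩
    (𝟙 - x ^ n) ⊕ (𝟙 - x) ⊛ x ^ n
      ≈⟨ solve 2 (λ x y → (con t1 :- y) :+ (con t1 :- x) :* y := con t1 :- x :* y) S.refl x (x ^ n) ⟩
    𝟙 - x ^ suc n ∎

  -- A finite geometric sum is an exact inverse once the remainder x^(N+1) vanishes; this is what
  -- truncation buys.
  1-nilpotent-inverse : ∀ x → x ^ suc N ≋ 𝟘 → (𝟙 - x) ⊛ geometric x (suc N) ≋ 𝟙
  1-nilpotent-inverse x x^≋0 = begin
    (𝟙 - x) ⊛ geometric x (suc N)    ≈⟨ geometric-sum x (suc N) ⟩
    𝟙 - x ^ suc N                    ≈⟨ S.+-congˡ (S.-‿cong x^≋0) ⟩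
    𝟙 - 𝟘                            ≈⟨ solve 0 (con t1 :- con t0 := con t1) S.refl ⟩
    𝟙                                ∎

  X-nilpotent : ∀ i → X (suc i) ^ suc N ≋ 𝟘
  X-nilpotent i = S.trans (X-^ (suc i) (suc N)) (X≋𝟘 (ℕ.m≤m*n (suc N) (suc i)))

  -X-nilpotent : ∀ i → (⊖ X (suc i)) ^ suc N ≋ 𝟘
  -X-nilpotent i = begin
    (⊖ x) ^ suc N                  ≈⟨ ^-congˡ (suc N) (solve 1 (λ x → :- x := (:- con t1) :* x) S.refl x) ⟩
    ((⊖ 𝟙) ⊛ x) ^ suc N            ≈⟨ ^-distrib-* (⊖ 𝟙) x (suc N) ⟩
    (⊖ 𝟙) ^ suc N ⊛ x ^ suc N      ≈⟨ S.*-congˡ (X-nilpotent i) ⟩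
    (⊖ 𝟙) ^ suc N ⊛ 𝟘              ≈⟨ S.zeroʳ ((⊖ 𝟙) ^ suc N) ⟩
    𝟘                              ∎
    where x = X (suc i)

  [1-X] [1+X] [1-X]⁻¹ [1+X]⁻¹ : ℕ → Series
  [1-X] i   = 𝟙 - X i
  [1+X] i   = 𝟙 ⊕ X i
  [1-X]⁻¹ i = geometric (X i) (suc N)
  [1+X]⁻¹ i = geometric (⊖ X i) (suc N)

  [1-X]-inverse : ∀ i → [1-X] (suc i) ⊛ [1-X]⁻¹ (suc i) ≋ 𝟙
  [1-X]-inverse i = 1-nilpotent-inverse (X (suc i)) (X-nilpotent i)

  [1+X]-inverse : ∀ i → [1+X] (suc i) ⊛ [1+X]⁻¹ (suc i) ≋ 𝟙
  [1+X]-inverse i = begin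
    (𝟙 ⊕ X (suc i)) ⊛ g      ≈⟨ solve 2 (λ x g → (con t1 :+ x) :* g := (con t1 :- (:- x)) :* g) S.refl (X (suc i)) g ⟩
    (𝟙 - (⊖ X (suc i))) ⊛ g  ≈⟨ 1-nilpotent-inverse (⊖ X (suc i)) (-X-nilpotent i) ⟩
    𝟙                        ∎
    where g = [1+X]⁻¹ (suc i)

  -- Generating functions of partitions

  open Algebra.Properties.Semiring.Mult semiring renaming (_×_ to _×ᴷ_) using (×-homo-+; ×1-homo-*)

  multiplicity : ℕ → ℕ → Series
  multiplicity c t = const (multichoose c t ×ᴷ 1#)

  partition : ℕ → ℕ → ℕ → Series
  partition r s m n = parts r s m n ×ᴷ 1#

  -- Counts the multisets of at most b parts of size w in c colors.
  copies : ℕ → ℕ → ℕ → Series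
  copies c w zero    = 𝟙
  copies c w (suc b) = copies c w b ⊕ multiplicity c (suc b) ⊛ X (suc b ℕ.* w)

  multiplicity-pascal : ∀ c t → multiplicity (suc c) (suc t) ≋ multiplicity c (suc t) ⊕ multiplicity (suc c) t
  multiplicity-pascal c t = pointwise λ n → trans
    (*-congʳ (trans (reflexive (≡.cong (_×ᴷ 1#) (multichoose-pascal c t)))
      (×-homo-+ 1# (multichoose c (suc t)) (multichoose (suc c) t))))
    (distribʳ _ _ _)

  multiplicity-zero : ∀ c → multiplicity c 0 ≋ 𝟙
  multiplicity-zero c = pointwise λ n → trans
    (*-congʳ (trans (reflexive (≡.cong (_×ᴷ 1#) (multichoose-zero c))) (+-identityʳ 1#)))
    (*-identityˡ _)

  -- Pascal's rule for multisets, summed over their sizes: removing one copy of the new color costs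
  -- a factor q^w and lowers the size bound by one.
  copies-pascal : ∀ c w b → copies (suc c) w (suc b) ≋ copies c w (suc b) ⊕ X w ⊛ copies (suc c) w b
  copies-pascal c w zero = begin
    𝟙 ⊕ multiplicity (suc c) 1 ⊛ X (1 ℕ.* w)
      ≈⟨ S.+-congˡ (S.*-congʳ (S.trans (multiplicity-pascal c 0) (S.+-congˡ (multiplicity-zero (suc c))))) ⟩
    𝟙 ⊕ (multiplicity c 1 ⊕ 𝟙) ⊛ X (1 ℕ.* w)
      ≈⟨ solve 2 (λ k x → con t1 :+ (k :+ con t1) :* x := (con t1 :+ k :* x) :+ x :* con t1)
           S.refl (multiplicity c 1) (X (1 ℕ.* w)) ⟩
    (𝟙 ⊕ multiplicity c 1 ⊛ X (1 ℕ.* w)) ⊕ X (1 ℕ.* w) ⊛ 𝟙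
      ≡⟨ ≡.cong (λ e → (𝟙 ⊕ multiplicity c 1 ⊛ X (1 ℕ.* w)) ⊕ X e ⊛ 𝟙) (ℕ.*-identityˡ w) ⟩
    (𝟙 ⊕ multiplicity c 1 ⊛ X (1 ℕ.* w)) ⊕ X w ⊛ 𝟙 ∎
  copies-pascal c w (suc b) = begin
    copies (suc c) w (suc b) ⊕ multiplicity (suc c) (2 ℕ.+ b) ⊛ z
      ≈⟨ S.+-cong (copies-pascal c w b) (S.*-congʳ (multiplicity-pascal c (suc b))) ⟩
    (B ⊕ X w ⊛ A) ⊕ (k ⊕ l) ⊛ z
      ≈⟨ S.+-congˡ (S.trans (S.distribʳ z k l) (S.+-congˡ (S.*-congˡ (X-+ w (suc b ℕ.* w))))) ⟩
    (B ⊕ X w ⊛ A) ⊕ (k ⊛ z ⊕ l ⊛ (X w ⊛ y))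
      ≈⟨ solve 6 (λ B x A kz l y → (B :+ x :* A) :+ (kz :+ l :* (x :* y)) := (B :+ kz) :+ x :* (A :+ l :* y))
           S.refl B (X w) A (k ⊛ z) l y ⟩
    (B ⊕ k ⊛ z) ⊕ X w ⊛ (A ⊕ l ⊛ y) ∎
    where
    z = X ((2 ℕ.+ b) ℕ.* w)
    y = X (suc b ℕ.* w)
    A = copies (suc c) w b
    B = copies c w (suc b)
    k = multiplicity c (2 ℕ.+ b)
    l = multiplicity (suc c) (suc b)

  copies-none : ∀ w b → copies 0 w b ≋ 𝟙
  copies-none w zero    = S.refl
  copies-none w (suc b) = begin
    copies 0 w b ⊕ const 0# ⊛ X (suc b ℕ.* w)    ≈⟨ S.+-cong (copies-none w b) (S.*-congʳ (pointwise λ n → zeroˡ _)) ⟩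
    𝟙 ⊕ 𝟘 ⊛ X (suc b ℕ.* w)                      ≈⟨ solve 1 (λ x → con t1 :+ con t0 :* x := con t1) S.refl (X (suc b ℕ.* w)) ⟩
    𝟙                                            ∎

  -- The expansion of 1 / (1 - q^w)^c, by induction on the number of colors.
  copies-inverse : ∀ c i → (𝟙 - X (suc i)) ^ c ⊛ copies c (suc i) N ≋ 𝟙
  copies-inverse zero    i = S.trans (S.*-identityˡ (copies 0 (suc i) N)) (copies-none (suc i) N)
  copies-inverse (suc c) i = begin
    ((𝟙 - x) ⊛ y) ⊛ copies (suc c) w N
      ≈⟨ solve 3 (λ a y g → (a :* y) :* g := y :* (a :* g)) S.refl (𝟙 - x) y (copies (suc c) w N) ⟩
    y ⊛ ((𝟙 - x) ⊛ copies (suc c) w N)       ≈⟨ S.*-congˡ recursion ⟩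
    y ⊛ copies c w N                         ≈⟨ copies-inverse c i ⟩
    𝟙                                        ∎
    where
    w = suc i
    x = X w
    y = (𝟙 - x) ^ c
    -- Pascal's rule shifts the bound by one. Bounds N + 1 and N agree here, since N + 1 parts of
    -- positive size exceed degree N.
    last-vanishes : ∀ c → copies c w (suc N) ≋ copies c w N
    last-vanishes c = begin
      copies c w N ⊕ multiplicity c (suc N) ⊛ X (suc N ℕ.* w)
        ≈⟨ S.+-congˡ (S.*-congˡ (X≋𝟘 (ℕ.m≤m*n (suc N) w))) ⟩
      copies c w N ⊕ multiplicity c (suc N) ⊛ 𝟘
        ≈⟨ solve 2 (λ g k → g :+ k :* con t0 := g) S.refl (copies c w N) (multiplicity c (suc N)) ⟩
      copies c w N ∎
    recursion : (𝟙 - x) ⊛ copies (suc c) w N ≋ copies c w N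
    recursion = begin
      (𝟙 - x) ⊛ g                                 ≈⟨ solve 2 (λ x g → (con t1 :- x) :* g := g :- x :* g) S.refl x g ⟩
      g - x ⊛ g                                   ≈⟨ S.+-congʳ (last-vanishes (suc c)) ⟨
      copies (suc c) w (suc N) - x ⊛ g            ≈⟨ S.+-congʳ (copies-pascal c w N) ⟩
      (copies c w (suc N) ⊕ x ⊛ g) - x ⊛ g        ≈⟨ solve 2 (λ h k → (h :+ k) :- k := h) S.refl (copies c w (suc N)) (x ⊛ g) ⟩
      copies c w (suc N)                          ≈⟨ last-vanishes c ⟩
      copies c w N                                ∎
      where g = copies (suc c) w N

  monomial-⊛ : ∀ k m f n → (const k ⊛ X m ⊛ f) n ≈ k * (X m ⊛ f) n
  monomial-⊛ k m f n = trans (⊛-assoc (const k) (X m) f n) (const-⊛ k (X m ⊛ f) n)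

  -- If the test fails, multiplication by q^e moves everything above degree n; if it succeeds,
  -- coefficient n after the shift is coefficient n - e before it.
  term-coefficient : ∀ r s m n t →
    term r s m n t ×ᴷ 1# ≈ (multiplicity (colors r s (suc m)) t ⊛ X (t ℕ.* suc m) ⊛ partition r s m) n
  term-coefficient r s m n t with t ℕ.* suc m ℕ.≤ᵇ n in eq
  ... | false = sym (trans (monomial-⊛ _ e (partition r s m) n)
                  (trans (*-congˡ (X⊛-< e (partition r s m) n (ℕ.≰⇒> λ e≤n → ≡.subst Bool.T eq (ℕ.≤⇒≤ᵇ e≤n)))) (zeroʳ _)))
    where e = t ℕ.* suc m
  ... | true  = trans (×1-homo-* (multichoose (colors r s (suc m)) t) (parts r s m (n ℕ.∸ e)))
                  (sym (trans (monomial-⊛ _ e (partition r s m) n) (*-congˡ shifted)))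
    where
    e = t ℕ.* suc m
    e≤n : e ℕ.≤ n
    e≤n = ℕ.≤ᵇ⇒≤ e n (≡.subst Bool.T (≡.sym eq) _)
    shifted : (X e ⊛ partition r s m) n ≈ partition r s m (n ℕ.∸ e)
    shifted = trans (reflexive (≡.cong (X e ⊛ partition r s m) (≡.sym (ℕ.m+[n∸m]≡n e≤n)))) (X⊛-+ e (partition r s m) (n ℕ.∸ e))

  sumT-coefficient : ∀ r s m n b →
    sumT r s m n b ×ᴷ 1# ≈ (copies (colors r s (suc m)) (suc m) b ⊛ partition r s m) n
  sumT-coefficient r s m n zero    = sym (⊛-identityˡ (partition r s m) n)
  sumT-coefficient r s m n (suc b) = trans (×-homo-+ 1# (sumT r s m n b) (term r s m n (suc b)))
    (trans (+-cong (sumT-coefficient r s m n b) (term-coefficient r s m n (suc b)))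
      (sym (⊛-distribʳ (partition r s m) (copies c (suc m) b) _ n)))
    where c = colors r s (suc m)

  -- `parts` bounds the number of copies by the coefficient index n, while the generating function
  -- uses the uniform bound N. The additional terms start above degree n.
  copies-stable : ∀ c i f n {b} → n ℕ.≤′ b → (copies c (suc i) b ⊛ f) n ≈ (copies c (suc i) n ⊛ f) n
  copies-stable c i f n ℕ.≤′-refl               = refl
  copies-stable c i f n (ℕ.≤′-step {b} n≤b) = trans (⊛-distribʳ f (copies c (suc i) b) _ n)
    (trans (+-cong (copies-stable c i f n n≤b)
        (trans (monomial-⊛ _ (suc b ℕ.* suc i) f n)
          (trans (*-congˡ (X⊛-< (suc b ℕ.* suc i) f n (ℕ.≤-trans (s≤s (ℕ.≤′⇒≤ n≤b)) (ℕ.m≤m*n (suc b) (suc i))))) (zeroʳ _))))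
      (+-identityʳ _))

  partition-suc : ∀ r s m → partition r s (suc m) ≋ copies (colors r s (suc m)) (suc m) N ⊛ partition r s m
  partition-suc r s m = agree λ n n≤N → trans (sumT-coefficient r s m n n)
    (sym (copies-stable (colors r s (suc m)) m (partition r s m) n (ℕ.≤⇒≤′ n≤N)))

  -- The product of these factors over all i is f₁^s f₂^(r-s), the denominator of the generating
  -- function of `a r s`.
  eulerFactor : ℕ → ℕ → ℕ → Series
  eulerFactor r s i = (𝟙 - X i) ^ colors r s i

  partition-inverse : ∀ r s m → ∏ (eulerFactor r s) m ⊛ partition r s m ≋ 𝟙
  partition-inverse r s zero    = S.trans (S.*-identityˡ (partition r s 0))
    (pointwise λ { zero → +-identityʳ 1# ; (suc n) → refl })
  partition-inverse r s (suc m) = begin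
    (E ⊛ F) ⊛ partition r s (suc m)            ≈⟨ S.*-congˡ (partition-suc r s m) ⟩
    (E ⊛ F) ⊛ (G ⊛ p)                          ≈⟨ solve 4 (λ E F G p → (E :* F) :* (G :* p) := (F :* G) :* (E :* p)) S.refl E F G p ⟩
    (F ⊛ G) ⊛ (E ⊛ p)                          ≈⟨ S.*-cong (copies-inverse (colors r s (suc m)) m) (partition-inverse r s m) ⟩
    𝟙 ⊛ 𝟙                                      ≈⟨ S.*-identityˡ 𝟙 ⟩
    𝟙                                          ∎
    where
    E = ∏ (eulerFactor r s) m
    F = eulerFactor r s (suc m)
    G = copies (colors r s (suc m)) (suc m) N
    p = partition r s m

  -- Gauss's identity

  -- `colors 0 1` is the indicator of odd numbers, so a product over all indices keeps only the odd
  -- ones.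
  oddFactor : ℕ → Series
  oddFactor i = (𝟙 - X i) ^ colors 0 1 i

  colors-odd : ∀ r s m → colors r s (suc (m ℕ.* 2)) ≡ s
  colors-odd r s m = ≡.cong (λ ρ → if ρ ℕ.≡ᵇ 0 then r else s) (ℕ.[m+kn]%n≡m%n 1 m 2)

  colors-even : ∀ r s m → colors r s (m ℕ.* 2) ≡ r
  colors-even r s m = ≡.cong (λ ρ → if ρ ℕ.≡ᵇ 0 then r else s) (ℕ.m*n%n≡0 m 2)

  -- The even factors of the right side come from (1 + q^i)(1 - q^i) = 1 - q^(2i); the odd ones are
  -- supplied separately.
  ∏-odd : ∀ m → (∏ oddFactor (m ℕ.* 2) ⊛ ∏ [1+X] m) ⊛ ∏ [1-X] m ≋ ∏ [1-X] (m ℕ.* 2)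
  ∏-odd zero    = solve 0 ((con t1 :* con t1) :* con t1 := con t1) S.refl
  ∏-odd (suc m) = begin
    ((O ⊛ oddFactor (suc (m ℕ.* 2)) ⊛ oddFactor (suc m ℕ.* 2)) ⊛ (A ⊛ (𝟙 ⊕ z))) ⊛ (B ⊛ (𝟙 - z))
      ≈⟨ S.*-congʳ (S.*-congʳ (S.*-cong (S.*-congˡ odd≈) even≈)) ⟩
    ((O ⊛ (𝟙 - y) ⊛ 𝟙) ⊛ (A ⊛ (𝟙 ⊕ z))) ⊛ (B ⊛ (𝟙 - z))
      ≈⟨ solve 5 (λ O A B y z →
           ((O :* (con t1 :- y) :* con t1) :* (A :* (con t1 :+ z))) :* (B :* (con t1 :- z))
           := ((O :* A) :* B) :* (con t1 :- y) :* (con t1 :- z :* z)) S.refl O A B y z ⟩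
    ((O ⊛ A) ⊛ B) ⊛ (𝟙 - y) ⊛ (𝟙 - z ⊛ z)
      ≈⟨ S.*-cong (S.*-congʳ (∏-odd m)) (S.+-congˡ (S.-‿cong (S.trans (S.sym (X-+ (suc m) (suc m))) (S.reflexive (≡.cong X double))))) ⟩
    ∏ [1-X] (suc m ℕ.* 2) ∎
    where
    O = ∏ oddFactor (m ℕ.* 2)
    A = ∏ [1+X] m
    B = ∏ [1-X] m
    y = X (suc (m ℕ.* 2))
    z = X (suc m)
    double : suc m ℕ.+ suc m ≡ suc m ℕ.* 2
    double = ≡.trans (≡.cong (suc m ℕ.+_) (≡.sym (ℕ.*-identityˡ (suc m)))) (ℕ.*-comm 2 (suc m))
    odd≈ : oddFactor (suc (m ℕ.* 2)) ≋ 𝟙 - y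
    odd≈ rewrite colors-odd 0 1 m = S.*-identityʳ (𝟙 - y)
    even≈ : oddFactor (suc m ℕ.* 2) ≋ 𝟙
    even≈ rewrite colors-even 0 1 (suc m) = S.refl

  ∏-stable : ∀ {F} → (∀ i → N ℕ.< i → F i ≋ 𝟙) → ∀ {m} → N ℕ.≤′ m → ∏ F m ≋ ∏ F N
  ∏-stable     F≋1 ℕ.≤′-refl             = S.refl
  ∏-stable {F} F≋1 (ℕ.≤′-step {m} N≤m) = begin
    ∏ F m ⊛ F (suc m)    ≈⟨ S.*-cong (∏-stable F≋1 N≤m) (F≋1 (suc m) (s≤s (ℕ.≤′⇒≤ N≤m))) ⟩
    ∏ F N ⊛ 𝟙            ≈⟨ S.*-identityʳ (∏ F N) ⟩
    ∏ F N                ∎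

  1-X≋1 : ∀ i → N ℕ.< i → 𝟙 - X i ≋ 𝟙
  1-X≋1 i N<i = S.trans (S.+-congˡ (S.-‿cong (X≋𝟘 N<i))) (solve 0 (con t1 :- con t0 := con t1) S.refl)

  [1-X]^≋1 : ∀ c i → N ℕ.< i → (𝟙 - X i) ^ c ≋ 𝟙
  [1-X]^≋1 c i N<i = S.trans (^-congˡ c (1-X≋1 i N<i)) (1^n≈1 c)

  -- Euler's theorem on odd and distinct parts.
  ∏-odd-[1+X] : ∏ oddFactor N ⊛ ∏ [1+X] N ≋ 𝟙
  ∏-odd-[1+X] = begin
    O ⊛ A                    ≈⟨ S.*-identityʳ (O ⊛ A) ⟨
    (O ⊛ A) ⊛ 𝟙              ≈⟨ S.*-congˡ (∏-inverse [1-X]-inverse N) ⟨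
    (O ⊛ A) ⊛ (B ⊛ C)        ≈⟨ S.*-assoc (O ⊛ A) B C ⟨
    ((O ⊛ A) ⊛ B) ⊛ C        ≈⟨ S.*-congʳ OAB≋B ⟩
    B ⊛ C                    ≈⟨ ∏-inverse [1-X]-inverse N ⟩
    𝟙                        ∎
    where
    O = ∏ oddFactor N
    A = ∏ [1+X] N
    B = ∏ [1-X] N
    C = ∏ [1-X]⁻¹ N
    N≤2N : N ℕ.≤′ N ℕ.* 2
    N≤2N = ℕ.≤⇒≤′ (ℕ.m≤m*n N 2)
    -- `∏-odd` relates products up to 2N to products up to N; modulo q^(N+1) all factors past N are
    -- 1.
    OAB≋B : (O ⊛ A) ⊛ B ≋ B
    OAB≋B = begin
      (O ⊛ A) ⊛ B                            ≈⟨ S.*-congʳ (S.*-congʳ (∏-stable (λ i → [1-X]^≋1 (colors 0 1 i) i) N≤2N)) ⟨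
      (∏ oddFactor (N ℕ.* 2) ⊛ A) ⊛ B        ≈⟨ ∏-odd N ⟩
      ∏ [1-X] (N ℕ.* 2)                      ≈⟨ ∏-stable 1-X≋1 N≤2N ⟩
      B                                      ∎

  open Gauss X X-+ [1+X]⁻¹ [1-X]⁻¹ [1+X]-inverse [1-X]-inverse public

  -- Every summand carries q^(s(N+1)) with s ≥ 1, so in degrees up to N the telescoped formula
  -- reduces to its product.
  tailSum-vanishes : ∀ m → tailSum m (suc N) ≋ 𝟘
  tailSum-vanishes zero    = S.refl
  tailSum-vanishes (suc m) = begin
    tailSum m (suc N) ⊕ κ ⊛ X (suc m ℕ.* suc N)    ≈⟨ S.+-cong (tailSum-vanishes m) (S.*-congˡ (X≋𝟘 (ℕ.m≤m+n (suc N) _))) ⟩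
    𝟘 ⊕ κ ⊛ 𝟘                                      ≈⟨ solve 1 (λ κ → con t0 :+ κ :* con t0 := con t0) S.refl κ ⟩
    𝟘                                              ∎
    where κ = sign (suc m) ⊛ (P⁻¹ m ⊛ [1-X]⁻¹ (suc m))

  -- Euler's theorem replaces 1 / ∏ (1 + q^i) by the product over odd exponents, f₁/f₂, which gives
  -- Gauss's f₁²/f₂.
  theta-product : theta N ≋ ∏ [1-X] N ⊛ ∏ oddFactor N
  theta-product = begin
    theta N                                ≈⟨ theta-tailSum N ⟨
    P N ⊛ (𝟙 ⊕ tailSum N (suc N))          ≈⟨ S.*-congˡ (S.+-congˡ (tailSum-vanishes N)) ⟩
    P N ⊛ (𝟙 ⊕ 𝟘)                          ≈⟨ solve 1 (λ p → p :* (con t1 :+ con t0) := p) S.refl (P N) ⟩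
    P N                                    ≈⟨ ∏-* [1-X] [1+X]⁻¹ N ⟩
    B ⊛ D                                  ≈⟨ S.*-congˡ (S.*-identityˡ D) ⟨
    B ⊛ (𝟙 ⊛ D)                            ≈⟨ S.*-congˡ (S.*-congʳ ∏-odd-[1+X]) ⟨
    B ⊛ ((O ⊛ A) ⊛ D)                      ≈⟨ S.*-congˡ (S.*-assoc O A D) ⟩
    B ⊛ (O ⊛ (A ⊛ D))                      ≈⟨ S.*-congˡ (S.*-congˡ (∏-inverse [1+X]-inverse N)) ⟩
    B ⊛ (O ⊛ 𝟙)                            ≈⟨ S.*-congˡ (S.*-identityʳ O) ⟩
    B ⊛ O                                  ∎
    where
    O = ∏ oddFactor N
    A = ∏ [1+X] N
    B = ∏ [1-X] N
    D = ∏ [1+X]⁻¹ N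

  -- The exponents 2 (even) and 4 (odd) are twice the exponents 1 and 2 in f₁²/f₂.
  theta²-product : ∏ (eulerFactor 2 4) N ≋ theta N ⊛ theta N
  theta²-product = begin
    ∏ (eulerFactor 2 4) N                     ≈⟨ ∏-cong (λ i → factor (suc i)) N ⟩
    ∏ (λ i → H i ⊛ H i) N                     ≈⟨ ∏-* H H N ⟩
    ∏ H N ⊛ ∏ H N                             ≈⟨ S.*-cong ∏H≋theta ∏H≋theta ⟩
    theta N ⊛ theta N                         ∎
    where
    H : ℕ → Series
    H i = [1-X] i ⊛ oddFactor i
    factor : ∀ i → eulerFactor 2 4 i ≋ H i ⊛ H i
    factor i with i % 2 ℕ.≡ᵇ 0
    ... | true  = solve 1 (λ x → x :* (x :* con t1) := (x :* con t1) :* (x :* con t1)) S.refl (𝟙 - X i)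
    ... | false = solve 1 (λ x → x :* (x :* (x :* (x :* con t1))) := (x :* (x :* con t1)) :* (x :* (x :* con t1))) S.refl (𝟙 - X i)
    ∏H≋theta : ∏ H N ≋ theta N
    ∏H≋theta = S.trans (∏-* [1-X] oddFactor N) (S.sym theta-product)

  partition-theta² : partition 2 4 N ⊛ (theta N ⊛ theta N) ≋ 𝟙
  partition-theta² = begin
    q ⊛ (theta N ⊛ theta N)          ≈⟨ S.*-congˡ theta²-product ⟨
    q ⊛ ∏ (eulerFactor 2 4) N        ≈⟨ S.*-comm q (∏ (eulerFactor 2 4) N) ⟩
    ∏ (eulerFactor 2 4) N ⊛ q        ≈⟨ partition-inverse 2 4 N ⟩
    𝟙                                ∎
    where q = partition 2 4 N

  -- The 3-dissection of theta

  cube-sign : ∀ s → cube (sign s) ≋ sign s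
  cube-sign zero    = solve 0 ((:- con t1) :* (:- con t1) :* (:- con t1) := :- con t1) S.refl
  cube-sign (suc s) = S.trans
    (solve 1 (λ x → (:- x) :* (:- x) :* (:- x) := :- (x :* x :* x)) S.refl (sign s))
    (S.-‿cong (cube-sign s))

  -- s and 3s have the same parity.
  sign-*3 : ∀ s → sign (s ℕ.* 3) ≋ sign s
  sign-*3 zero    = S.refl
  sign-*3 (suc s) = S.trans
    (solve 1 (λ x → :- (:- (:- x)) := :- x) S.refl (sign (s ℕ.* 3)))
    (S.-‿cong (sign-*3 s))

  cube²-monomial : ∀ s e → cube (cube (sign s ⊛ X e)) ≋ sign s ⊛ X (e ℕ.* 3 ℕ.* 3)
  cube²-monomial s e = S.trans (cube-cong (step e)) (step (e ℕ.* 3))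
    where
    step : ∀ e → cube (sign s ⊛ X e) ≋ sign s ⊛ X (e ℕ.* 3)
    step e = S.trans (cube-* (sign s) (X e)) (S.*-cong (cube-sign s) (cube-X e))

  monomial : ℕ → Series
  monomial s = sign s ⊛ X (s ℕ.* s)

  -- The remainder R of the dissection: the terms of `theta` with s prime to 3 and s < 3m.
  nonmultiples : ℕ → Series
  nonmultiples zero    = 𝟘
  nonmultiples (suc m) = nonmultiples m ⊕ (monomial (1 ℕ.+ m ℕ.* 3) ⊕ monomial (2 ℕ.+ m ℕ.* 3))

  -- Since (3s)² = 9s², the terms at multiples of 3 form `theta m` with q⁹ in place of q, which is
  -- its cube taken twice.
  theta-*3 : ∀ m → theta (m ℕ.* 3) ≋ cube (cube (theta m)) ⊕ nonmultiples m
  theta-*3 zero    = solve 0 (con t1 := t :* t :* t :+ con t0) S.refl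
    where t = con t1 :* con t1 :* con t1
  theta-*3 (suc m) = begin
    theta (m ℕ.* 3) ⊕ x ⊕ y ⊕ monomial (suc m ℕ.* 3)
      ≈⟨ S.+-cong (S.+-congʳ (S.+-congʳ (theta-*3 m))) last ⟩
    (T ⊕ nonmultiples m) ⊕ x ⊕ y ⊕ cube (cube (monomial (suc m)))
      ≈⟨ solve 5 (λ T n x y z → (T :+ n) :+ x :+ y :+ z := (T :+ z) :+ (n :+ (x :+ y)))
           S.refl T (nonmultiples m) x y (cube (cube (monomial (suc m)))) ⟩
    (T ⊕ cube (cube (monomial (suc m)))) ⊕ nonmultiples (suc m)
      ≈⟨ S.+-congʳ (cube-+ (cube (theta m)) (cube (monomial (suc m)))) ⟨
    cube (cube (theta m) ⊕ cube (monomial (suc m))) ⊕ nonmultiples (suc m)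
      ≈⟨ S.+-congʳ (cube-cong (cube-+ (theta m) (monomial (suc m)))) ⟨
    cube (cube (theta (suc m))) ⊕ nonmultiples (suc m) ∎
    where
    T = cube (cube (theta m))
    x = monomial (1 ℕ.+ m ℕ.* 3)
    y = monomial (2 ℕ.+ m ℕ.* 3)
    square-*3 : ∀ k → (k ℕ.* 3) ℕ.* (k ℕ.* 3) ≡ k ℕ.* k ℕ.* 3 ℕ.* 3
    square-*3 = +-*-Solver.solve 1 (λ k → (k :*ℕ three) :*ℕ (k :*ℕ three) :=ℕ k :*ℕ k :*ℕ three :*ℕ three) ≡.refl
      where
      open +-*-Solver using () renaming (_:*_ to _:*ℕ_; _:=_ to _:=ℕ_)
      three = +-*-Solver.con 3
    last : monomial (suc m ℕ.* 3) ≋ cube (cube (monomial (suc m)))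
    last = begin
      sign (suc m ℕ.* 3) ⊛ X ((suc m ℕ.* 3) ℕ.* (suc m ℕ.* 3))
        ≈⟨ S.*-cong (sign-*3 (suc m)) (S.reflexive (≡.cong X (square-*3 (suc m)))) ⟩
      sign (suc m) ⊛ X (suc m ℕ.* suc m ℕ.* 3 ℕ.* 3)
        ≈⟨ cube²-monomial (suc m) (suc m ℕ.* suc m) ⟨
      cube (cube (monomial (suc m))) ∎

  theta-stable : ∀ {m} → N ℕ.≤′ m → theta m ≋ theta N
  theta-stable ℕ.≤′-refl           = S.refl
  theta-stable (ℕ.≤′-step {m} N≤m) = begin
    theta m ⊕ sign (suc m) ⊛ X (suc m ℕ.* suc m)
      ≈⟨ S.+-cong (theta-stable N≤m) (S.*-congˡ (X≋𝟘 (ℕ.≤-trans (s≤s (ℕ.≤′⇒≤ N≤m)) (ℕ.m≤m*n (suc m) (suc m))))) ⟩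
    theta N ⊕ sign (suc m) ⊛ 𝟘
      ≈⟨ solve 2 (λ t s → t :+ s :* con t0 := t) S.refl (theta N) (sign (suc m)) ⟩
    theta N ∎

  -- The split needs an upper index divisible by 3; 3N serves, as the terms past index N have degree
  -- above N.
  theta-dissection : theta N ≋ cube (cube (theta N)) ⊕ nonmultiples N
  theta-dissection = S.trans (S.sym (theta-stable (ℕ.≤⇒≤′ (ℕ.m≤m*n N 3)))) (theta-*3 N)

  supported-sign : ∀ s → Supported 3 0 (sign s)
  supported-sign zero    = supported-⊖ 3 (supported-X 3 0 ≡.refl)
  supported-sign (suc s) = supported-⊖ 3 (supported-sign s)

  -- The square of a number prime to 3 is 1 mod 3, and signs are constants.
  supported-nonmultiples : ∀ m → Supported 3 1 (nonmultiples m)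
  supported-nonmultiples zero    = supported-𝟘 3
  supported-nonmultiples (suc m) = supported-⊕ 3 (supported-nonmultiples m)
    (supported-⊕ 3 (square (1 ℕ.+ m ℕ.* 3) (≡.cong (λ r → (r ℕ.* r) % 3) (ℕ.[m+kn]%n≡m%n 1 m 3)))
                   (square (2 ℕ.+ m ℕ.* 3) (≡.cong (λ r → (r ℕ.* r) % 3) (ℕ.[m+kn]%n≡m%n 2 m 3))))
    where
    square : ∀ k → ((k % 3) ℕ.* (k % 3)) % 3 ≡ 1 → Supported 3 1 (monomial k)
    square k k²≡1 = supported-⊛ 3 (supported-sign k) (supported-X 3 (k ℕ.* k) (≡.trans (ℕ.%-distribˡ-* k k 3) k²≡1))

  -- With q the partition series, q = φ⁻², so `q ⊛ t` plays the role of φ⁻¹ and `J` that of φ⁻³; `T`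
  -- is φ²⁷ and `r` is R³.
  partition-dissection : let T = cube (cube (cube (theta N))) ; r = cube (nonmultiples N) in
    partition 2 4 N ≋ T ⊛ T ⊕ (T ⊛ r ⊕ T ⊛ r) ⊕ r ⊛ r ⊕ nonmultiples N ⊛ cube (partition 2 4 N ⊛ theta N)
  partition-dissection = begin
    q                                         ≈⟨ S.*-identityˡ q ⟨
    𝟙 ⊛ q                                     ≈⟨ S.*-congʳ partition-theta² ⟨
    (q ⊛ (t ⊛ t)) ⊛ q                         ≈⟨ S.*-identityˡ _ ⟨
    𝟙 ⊛ ((q ⊛ (t ⊛ t)) ⊛ q)                   ≈⟨ S.*-congʳ partition-theta² ⟨
    (q ⊛ (t ⊛ t)) ⊛ ((q ⊛ (t ⊛ t)) ⊛ q)
      -- Two factors 1 = q φ² were inserted so that q becomes φ (q φ)³.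
      ≈⟨ solve 2 (λ q t → (q :* (t :* t)) :* ((q :* (t :* t)) :* q)
           := t :* ((q :* t) :* (q :* t) :* (q :* t))) S.refl q t ⟩
    t ⊛ J                                     ≈⟨ S.*-congʳ theta-dissection ⟩
    (t⁹ ⊕ R) ⊛ J                              ≈⟨ S.distribʳ J t⁹ R ⟩
    t⁹ ⊛ J ⊕ R ⊛ J                            ≈⟨ S.+-congʳ t⁹J ⟩
    T ⊛ T ⊕ (T ⊛ r ⊕ T ⊛ r) ⊕ r ⊛ r ⊕ R ⊛ J   ∎
    where
    q  = partition 2 4 N
    t  = theta N
    t³ = cube t
    t⁹ = cube t³
    T  = cube t⁹
    R  = nonmultiples N
    r  = cube R
    J  = cube (q ⊛ t)
    cube-t : t³ ≋ T ⊕ r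
    cube-t = S.trans (cube-cong theta-dissection) (cube-+ t⁹ R)
    t⁹J : t⁹ ⊛ J ≋ T ⊛ T ⊕ (T ⊛ r ⊕ T ⊛ r) ⊕ r ⊛ r
    -- φ⁹ φ⁻³ = (φ³)² because `J ⊛ t³` is the cube of q φ² = 1; then φ³ = T + r is squared.
    t⁹J = begin
      t⁹ ⊛ J
        ≈⟨ solve 2 (λ c qt → (c :* c :* c) :* qt := (c :* c) :* (qt :* c)) S.refl t³ J ⟩
      (t³ ⊛ t³) ⊛ (J ⊛ t³)
        ≈⟨ S.*-congˡ (cube-* (q ⊛ t) t) ⟨
      (t³ ⊛ t³) ⊛ cube (q ⊛ t ⊛ t)
        ≈⟨ S.*-congˡ (cube-cong (S.trans (S.*-assoc q t t) partition-theta²)) ⟩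
      (t³ ⊛ t³) ⊛ cube 𝟙
        ≈⟨ S.*-congʳ (S.*-cong cube-t cube-t) ⟩
      ((T ⊕ r) ⊛ (T ⊕ r)) ⊛ cube 𝟙
        ≈⟨ solve 2 (λ T r → ((T :+ r) :* (T :+ r)) :* (con t1 :* con t1 :* con t1)
             := T :* T :+ (T :* r :+ T :* r) :+ r :* r) S.refl T r ⟩
      T ⊛ T ⊕ (T ⊛ r ⊕ T ⊛ r) ⊕ r ⊛ r ∎

  -- Vanishing on the exponents 9 and 18 modulo 27.

  VanishesOn9∖27 : Series → Set
  VanishesOn9∖27 f = ∀ n → n ℕ.≤ N → n % 9 ≡ 0 → n % 27 ≢ 0 → f n ≈ 0#

  partition-2-4-vanishes : VanishesOn9∖27 (partition 2 4 N)
  partition-2-4-vanishes n n≤N n≡0 n≢0 = trans (coefficient partition-dissection n n≤N)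
    (sum-zero (sum-zero (sum-zero TT (sum-zero Tr Tr)) rr) RJ)
    where
    sum-zero : ∀ {x y} → x ≈ 0# → y ≈ 0# → x + y ≈ 0#
    sum-zero x≈0 y≈0 = trans (+-cong x≈0 y≈0) (+-identityˡ 0#)
    -- Starting point for `supported-cube`: modulo 1 there is no restriction, and each cubing
    -- triples the modulus.
    anything : ∀ f → Supported 1 0 f
    anything f n _ n≢0 = contradiction (ℕ.n%1≡0 n) n≢0
    t = theta N
    T = cube (cube (cube t))
    R = nonmultiples N
    r = cube R
    J = cube (partition 2 4 N ⊛ t)
    -- `T` is needed with two moduli: 27 for its square, and 9 for its product with `r`, whose
    -- support is known only modulo 9.
    supported-T₉ : Supported 9 0 T
    supported-T₉ = supported-cube 3 (supported-cube 1 (anything (cube t)))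
    supported-r : Supported 9 3 r
    supported-r = supported-cube 3 (supported-nonmultiples N)
    supported-T₂₇ : Supported 27 0 T
    supported-T₂₇ = supported-cube 9 (supported-cube 3 (supported-cube 1 (anything t)))
    ≢-residue : ∀ {k a b} .{{_ : NonZero k}} → n % k ≡ a → a ≢ b → n % k ≢ b
    ≢-residue ≡.refl a≢b = a≢b
    TT : (T ⊛ T) n ≈ 0#
    TT = supported-⊛ 27 supported-T₂₇ supported-T₂₇ n n≤N n≢0
    Tr : (T ⊛ r) n ≈ 0#
    Tr = supported-⊛ 9 supported-T₉ supported-r n n≤N (≢-residue n≡0 λ ())
    rr : (r ⊛ r) n ≈ 0#
    rr = supported-⊛ 9 supported-r supported-r n n≤N (≢-residue n≡0 λ ())
    RJ : (R ⊛ J) n ≈ 0#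
    RJ = supported-⊛ 3 (supported-nonmultiples N) (supported-cube 1 (anything (partition 2 4 N ⊛ t))) n n≤N
      (≢-residue (≡.trans (≡.sym (ℕ.m∣n⇒o%n%m≡o%m 3 9 n (divides-refl 3))) (≡.cong (_% 3) n≡0)) λ ())

  -- Factors in q²⁷

  vanishes-≋ : ∀ {f g} → f ≋ g → VanishesOn9∖27 g → VanishesOn9∖27 f
  vanishes-≋ (agree p) vg n n≤N n≡0 n≢0 = trans (p n n≤N) (vg n n≤N n≡0 n≢0)

  -- Strong induction on the exponent via g = h + q^e g with e a positive multiple of 27: the shift
  -- by e decreases the exponent and keeps its residues modulo 9 and 27.
  vanishes-cancel : ∀ i g → VanishesOn9∖27 ((𝟙 - X (suc i ℕ.* 27)) ⊛ g) → VanishesOn9∖27 g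
  vanishes-cancel i g vh = <-rec _ step
    where
    e = suc i ℕ.* 27
    h = (𝟙 - X e) ⊛ g
    g≋ : g ≋ h ⊕ X e ⊛ g
    g≋ = solve 2 (λ x g → g := (con t1 :- x) :* g :+ x :* g) S.refl (X e) g
    step : ∀ n → (∀ {m} → m ℕ.< n → m ℕ.≤ N → m % 9 ≡ 0 → m % 27 ≢ 0 → g m ≈ 0#) →
           n ℕ.≤ N → n % 9 ≡ 0 → n % 27 ≢ 0 → g n ≈ 0#
    step n ih n≤N n≡0 n≢0 = trans (coefficient g≋ n n≤N)
      (trans (+-cong (vh n n≤N n≡0 n≢0) shifted) (+-identityˡ 0#))
      where
      shifted : (X e ⊛ g) n ≈ 0#
      shifted with e ℕ.≤? n
      ... | no e≰n = X⊛-< e g n (ℕ.≰⇒> e≰n)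
      ... | yes e≤n = trans (reflexive (≡.cong (X e ⊛ g) (≡.sym e+m≡n))) (trans (X⊛-+ e g m)
              (ih (ℕ.∸-monoʳ-< (s≤s z≤n) e≤n) (ℕ.≤-trans (ℕ.m∸n≤m n e) n≤N)
                (≡.trans (≡.sym residue₉) n≡0) λ m≡0 → n≢0 (≡.trans residue₂₇ m≡0)))
        where
        m = n ℕ.∸ e
        e+m≡n : e ℕ.+ m ≡ n
        e+m≡n = ℕ.m+[n∸m]≡n e≤n
        residue₂₇ : n % 27 ≡ m % 27
        residue₂₇ = ≡.trans (≡.cong (_% 27) (≡.sym e+m≡n)) (ℕ.%-remove-+ˡ m (divides-refl (suc i)))
        residue₉ : n % 9 ≡ m % 9
        residue₉ = ≡.trans (≡.sym (ℕ.m∣n⇒o%n%m≡o%m 9 27 n (divides-refl 3)))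
          (≡.trans (≡.cong (_% 9) residue₂₇) (ℕ.m∣n⇒o%n%m≡o%m 9 27 m (divides-refl 3)))

  vanishes-cancel-^ : ∀ i c g → VanishesOn9∖27 ((𝟙 - X (suc i ℕ.* 27)) ^ c ⊛ g) → VanishesOn9∖27 g
  vanishes-cancel-^ i zero    g v = vanishes-≋ (S.sym (S.*-identityˡ g)) v
  vanishes-cancel-^ i (suc c) g v = vanishes-cancel-^ i c g
    (vanishes-cancel i (y ^ c ⊛ g) (vanishes-≋ (S.sym (S.*-assoc y (y ^ c) g)) v))
    where y = 𝟙 - X (suc i ℕ.* 27)

  factor₂₇ : ℕ → ℕ → ℕ → Series
  factor₂₇ d d′ i = (𝟙 - X (i ℕ.* 27)) ^ colors d d′ i

  vanishes-cancel-∏ : ∀ d d′ m g → VanishesOn9∖27 (∏ (factor₂₇ d d′) m ⊛ g) → VanishesOn9∖27 g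
  vanishes-cancel-∏ d d′ zero    g v = vanishes-≋ (S.sym (S.*-identityˡ g)) v
  vanishes-cancel-∏ d d′ (suc m) g v = vanishes-cancel-^ m (colors d d′ (suc m)) g
    (vanishes-cancel-∏ d d′ m (F ⊛ g) (vanishes-≋ (S.sym (S.*-assoc (∏ (factor₂₇ d d′) m) F g)) v))
    where F = factor₂₇ d d′ (suc m)

  -- Cubing three times gives (1 - q^i)^27 = 1 - q^(27i), so the multiples of 27 in the exponents
  -- contribute only powers of q^27.
  eulerFactor-split : ∀ d d′ i →
    eulerFactor (27 ℕ.* d ℕ.+ 2) (27 ℕ.* d′ ℕ.+ 4) i ≋ factor₂₇ d d′ i ⊛ eulerFactor 2 4 i
  eulerFactor-split d d′ i = begin
    y ^ colors (27 ℕ.* d ℕ.+ 2) (27 ℕ.* d′ ℕ.+ 4) i  ≡⟨ ≡.cong (y ^_) (colors-linear 27 d d′ 2 4 i) ⟩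
    y ^ (27 ℕ.* c ℕ.+ colors 2 4 i)                  ≈⟨ ^-homo-* y (27 ℕ.* c) (colors 2 4 i) ⟩
    y ^ (27 ℕ.* c) ⊛ eulerFactor 2 4 i               ≈⟨ S.*-congʳ (^-assocʳ y 27 c) ⟨
    (y ^ 27) ^ c ⊛ eulerFactor 2 4 i                 ≈⟨ S.*-congʳ (^-congˡ c (S.trans (^27≈cube³ y) cube³)) ⟩
    factor₂₇ d d′ i ⊛ eulerFactor 2 4 i              ∎
    where
    y = 𝟙 - X i
    c = colors d d′ i
    cube-1-X : ∀ m → cube (𝟙 - X m) ≋ 𝟙 - X (m ℕ.* 3)
    cube-1-X m = S.trans (cube-1- (X m)) (S.+-congˡ (S.-‿cong (cube-X m)))
    27≡3³ : i ℕ.* 3 ℕ.* 3 ℕ.* 3 ≡ i ℕ.* 27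
    27≡3³ = ≡.trans (ℕ.*-assoc (i ℕ.* 3) 3 3) (ℕ.*-assoc i 3 9)
    cube³ : cube (cube (cube y)) ≋ 𝟙 - X (i ℕ.* 27)
    cube³ = begin
      cube (cube (cube y))              ≈⟨ cube-cong (cube-cong (cube-1-X i)) ⟩
      cube (cube (𝟙 - X (i ℕ.* 3)))     ≈⟨ cube-cong (cube-1-X (i ℕ.* 3)) ⟩
      cube (𝟙 - X (i ℕ.* 3 ℕ.* 3))      ≈⟨ cube-1-X (i ℕ.* 3 ℕ.* 3) ⟩
      𝟙 - X (i ℕ.* 3 ℕ.* 3 ℕ.* 3)       ≡⟨ ≡.cong (λ k → 𝟙 - X k) 27≡3³ ⟩
      𝟙 - X (i ℕ.* 27)                  ∎

  -- From F = D E and F p = 1 = E q it follows that D p = q; the factors of D in q^27 can then be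
  -- cancelled one at a time.
  partition-vanishes : ∀ d d′ → VanishesOn9∖27 (partition (27 ℕ.* d ℕ.+ 2) (27 ℕ.* d′ ℕ.+ 4) N)
  partition-vanishes d d′ = vanishes-cancel-∏ d d′ N p (vanishes-≋ Dp≋q partition-2-4-vanishes)
    where
    p = partition (27 ℕ.* d ℕ.+ 2) (27 ℕ.* d′ ℕ.+ 4) N
    q = partition 2 4 N
    D = ∏ (factor₂₇ d d′) N
    E = ∏ (eulerFactor 2 4) N
    F = ∏ (eulerFactor (27 ℕ.* d ℕ.+ 2) (27 ℕ.* d′ ℕ.+ 4)) N
    F≋DE : F ≋ D ⊛ E
    F≋DE = S.trans (∏-cong (λ i → eulerFactor-split d d′ (suc i)) N) (∏-* (factor₂₇ d d′) (eulerFactor 2 4) N)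
    Dp≋q : D ⊛ p ≋ q
    Dp≋q = begin
      D ⊛ p                    ≈⟨ S.*-identityʳ (D ⊛ p) ⟨
      (D ⊛ p) ⊛ 𝟙              ≈⟨ S.*-congˡ (partition-inverse 2 4 N) ⟨
      (D ⊛ p) ⊛ (E ⊛ q)        ≈⟨ solve 4 (λ D p E q → (D :* p) :* (E :* q) := ((D :* E) :* p) :* q) S.refl D p E q ⟩
      ((D ⊛ E) ⊛ p) ⊛ q        ≈⟨ S.*-congʳ (S.*-congʳ F≋DE) ⟨
      (F ⊛ p) ⊛ q              ≈⟨ S.*-congʳ (partition-inverse (27 ℕ.* d ℕ.+ 2) (27 ℕ.* d′ ℕ.+ 4) N) ⟩
      𝟙 ⊛ q                    ≈⟨ S.*-identityˡ q ⟩
      q                        ∎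

-- The integers modulo 3 and the congruences.

-- Congruence on natural numbers serves as the ring equality, so a vanishing coefficient is
-- literally a divisibility statement. Negation is doubling, as -1 = 2.
ℤ/3 : CommutativeRing 0ℓ 0ℓ
ℤ/3 = record
  { Carrier = ℕ
  ; _≈_ = λ x y → x % 3 ≡ y % 3
  ; _+_ = ℕ._+_
  ; _*_ = ℕ._*_
  ; -_ = 2 ℕ.*_
  ; 0# = 0
  ; 1# = 1
  ; isCommutativeRing = record
    { isRing = record
      { +-isAbelianGroup = record
        { isGroup = record
          { isMonoid = record
            { isSemigroup = record
              { isMagma = record
                { isEquivalence = record { refl = ≡.refl ; sym = ≡.sym ; trans = ≡.trans }
                ; ∙-cong = λ {x} {y} {u} {v} → +-cong x y u v
                }
              ; assoc = λ x y z → ≡.cong (_% 3) (ℕ.+-assoc x y z)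
              }
            ; identity = (λ _ → ≡.refl) , (λ x → ≡.cong (_% 3) (ℕ.+-identityʳ x))
            }
          ; inverse = (λ x → ≡.trans (≡.cong (_% 3) (ℕ.+-comm (2 ℕ.* x) x)) (3x≈0 x)) , 3x≈0
          ; ⁻¹-cong = λ {x} {y} x≈y → *-cong 2 2 x y ≡.refl x≈y
          }
        ; comm = λ x y → ≡.cong (_% 3) (ℕ.+-comm x y)
        }
      ; *-cong = λ {x} {y} {u} {v} → *-cong x y u v
      ; *-assoc = λ x y z → ≡.cong (_% 3) (ℕ.*-assoc x y z)
      ; *-identity = (λ x → ≡.cong (_% 3) (ℕ.*-identityˡ x)) , (λ x → ≡.cong (_% 3) (ℕ.*-identityʳ x))
      ; distrib = (λ x y z → ≡.cong (_% 3) (ℕ.*-distribˡ-+ x y z)) , (λ x y z → ≡.cong (_% 3) (ℕ.*-distribʳ-+ x y z))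
      }
    ; *-comm = λ x y → ≡.cong (_% 3) (ℕ.*-comm x y)
    }
  }
  where
  +-cong : ∀ x y u v → x % 3 ≡ y % 3 → u % 3 ≡ v % 3 → (x ℕ.+ u) % 3 ≡ (y ℕ.+ v) % 3
  +-cong x y u v x≈y u≈v = ≡.trans (ℕ.%-distribˡ-+ x u 3)
    (≡.trans (≡.cong₂ (λ i j → (i ℕ.+ j) % 3) x≈y u≈v) (≡.sym (ℕ.%-distribˡ-+ y v 3)))
  *-cong : ∀ x y u v → x % 3 ≡ y % 3 → u % 3 ≡ v % 3 → (x ℕ.* u) % 3 ≡ (y ℕ.* v) % 3
  *-cong x y u v x≈y u≈v = ≡.trans (ℕ.%-distribˡ-* x u 3)
    (≡.trans (≡.cong₂ (λ i j → (i ℕ.* j) % 3) x≈y u≈v) (≡.sym (ℕ.%-distribˡ-* y v 3)))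
  3x≈0 : ∀ x → (x ℕ.+ 2 ℕ.* x) % 3 ≡ 0
  3x≈0 x = ≡.trans (≡.cong (_% 3) (ℕ.*-comm 3 x)) (ℕ.m*n%n≡0 x 3)

-- Fermat's little theorem for 3, by inspection of the three residues.
ℤ/3-selfCubed : SelfCubed ℤ/3
ℤ/3-selfCubed x = begin
  (x ℕ.* x ℕ.* x) % 3                            ≡⟨ ℕ.%-distribˡ-* (x ℕ.* x) x 3 ⟩
  ((x ℕ.* x) % 3 ℕ.* (x % 3)) % 3                ≡⟨ ≡.cong (λ y → (y ℕ.* (x % 3)) % 3) (ℕ.%-distribˡ-* x x 3) ⟩
  (((x % 3) ℕ.* (x % 3)) % 3 ℕ.* (x % 3)) % 3    ≡⟨ residues (x % 3) (ℕ.m%n<n x 3) ⟩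
  x % 3                                          ∎
  where
  open ≡.≡-Reasoning
  residues : ∀ y → y ℕ.< 3 → ((y ℕ.* y) % 3 ℕ.* y) % 3 ≡ y
  residues 0 _ = ≡.refl
  residues 1 _ = ≡.refl
  residues 2 _ = ≡.refl
  residues (suc (suc (suc _))) (s≤s (s≤s (s≤s ())))

a-vanishes : ∀ d d′ n → n % 9 ≡ 0 → n % 27 ≢ 0 → a (27 ℕ.* d ℕ.+ 2) (27 ℕ.* d′ ℕ.+ 4) n % 3 ≡ 0
a-vanishes d d′ n n≡0 n≢0 = ≡.trans (≡.cong (_% 3) (≡.sym (×1≡ (a (27 ℕ.* d ℕ.+ 2) (27 ℕ.* d′ ℕ.+ 4) n))))
  (partition-vanishes d d′ n ℕ.≤-refl n≡0 n≢0)
  where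
  -- The truncation degree is n itself: `a r s n` bounds the parts by n, so it is coefficient n of
  -- `partition r s n`.
  open Series₃ ℤ/3 ≡.refl ℤ/3-selfCubed n using (partition-vanishes)
  open Algebra.Properties.Semiring.Mult (CommutativeRing.semiring ℤ/3) using (_×_)
  ×1≡ : ∀ m → m × 1 ≡ m
  ×1≡ zero    = ≡.refl
  ×1≡ (suc m) = ≡.cong suc (×1≡ m)

open import Data.Nat using (_+_; _*_; _∸_; _≤_)
open import Data.Product using (_×_)

theorem1p7 : ∀ (n k j : ℕ) → j ≤ k →
    (a (27 * (k ∸ j) + 2) (27 * k + 4) (27 * n + 9) % 3 ≡ 0)
    × (a (27 * (k ∸ j) + 2) (27 * k + 4) (27 * n + 18) % 3 ≡ 0)
theorem1p7 n k j _ = vanishes 9 ≡.refl (λ ()) , vanishes 18 ≡.refl (λ ())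
  where
  vanishes : ∀ c → c % 9 ≡ 0 → c % 27 ≢ 0 → a (27 * (k ∸ j) + 2) (27 * k + 4) (27 * n + c) % 3 ≡ 0
  -- 27n is zero modulo both 9 and 27, so both residue conditions reduce to those on `c`.
  vanishes c c≡0 c≢0 = a-vanishes (k ∸ j) k (27 * n + c)
    (≡.trans (ℕ.%-remove-+ˡ c (∣-trans (divides-refl 3) (m∣m*n n))) c≡0)
    (λ e → c≢0 (≡.trans (≡.sym (ℕ.%-remove-+ˡ c (m∣m*n n))) e))
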